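{- Let $n\geq 5$ be an integer and regard $\tilde{J}'=\tilde{J}(n-1,2)=(1^2,0^{n-3},0)^{P'}$ as a subset of the $(n-1)$-dimensional Euclidean space $H=\{(x_1,\dots,x_n)\in\mathbb{R}^n:\sum_i x_i=2\}\simeq\mathbb{R}^{n-1}$. Define (with matching choices of upper or lower signs within each set) $$X_1^{\pm}=\left\{\left(\left(\tfrac{2n\pm2\sqrt n}{n(n-1)}\right)^{n-1},\ \mp\tfrac{2\sqrt n}{n}\right)\right\},\qquad X_2^{\pm}=\left\{\left(\left(\tfrac{2n\pm\sqrt{2n^2+2n}}{n(n-1)}\right)^{n-1},\ \mp\tfrac{\sqrt{2n^2+2n}}{n}\right)\right\},$$ $$X_3^{\pm}=\left(\tfrac{n\pm1}{n-1},\ \left(\tfrac{1\pm1}{n-1}\right)^{n-2},\ \mp1\right)^{P'},$$ and, when $n\leq 10$, $$X_4^{\pm}=\left(\left(\tfrac{3n\pm\sqrt{10n-n^2}}{n(n-1)}\right)^{n-2},\ \tfrac{ -n^2+4n\pm\sqrt{10n-n^2}}{n(n-1)},\ \mp\tfrac{\sqrt{10n-n^2}}{n}\right)^{P'}$$ (so $X_4^+=X_4^-$ when $n=10$); for $n>10$ the sets $X_4^\pm$ are absent. (1) A vector $x\in H\setminus\tilde{J}'$ can be added to $\tilde{J}'$ while maintaining two-distance (i.e. $\tilde{J}'\cup\{x\}$ is a two-distance set) if and only if $x$ belongs to one of the sets $X_i^{\pm}$. Moreover, for each of these sets, all of its vectors can be added simultaneously: $\tilde{J}'\cup X_i^{+}$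 and $\tilde{J}'\cup X_i^{ - }$ are two-distance sets. (2) The combinations (unions) $U$ of at least two distinct sets among the $X_i^{\pm}$ for which $\tilde{J}'\cup U$ is a two-distance set are exactly the following ones and the sub-unions of them (the total number of vectors of $\tilde{J}'\cup U$ is given in brackets): - $n=5$: $X_1^+\cup X_1^-$ $[8]$; - $n=6$: $X_1^+\cup X_4^-$ $[16]$ and $X_1^-\cup X_4^+$ $[16]$; - $n=7$: $X_4^+\cup X_4^-$ $[27]$; - $n=8$: $X_2^+\cup X_4^+$ $[29]$ and $X_2^-\cup X_4^-$ $[29]$; - $n=9$: $X_1^+\cup X_1^-$ $[30]$, $X_1^+\cup X_3^-\cup X_4^-$ $[45]$ and $X_1^-\cup X_3^+\cup X_4^+$ $[45]$; - $n=17$: $X_1^+\cup X_2^-$ $[122]$ and $X_1^-\cup X_2^+$ $[122]$.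
   Context: Notation: inside parentheses, exponents are multiplicities of coordinates, not powers. For a vector of length $n$ written in this way, the exponent $P'$ outside the parentheses denotes the set of all vectors obtained from it by permuting the first $n-1$ coordinates, the last coordinate being fixed. Thus $\tilde{J}(n-1,2)=(1^2,0^{n-3},0)^{P'}$ is the set of all $0/1$ vectors of length $n$ with exactly two ones and last coordinate $0$ (a representation of the Johnson graph $J(n-1,2)$ in $\mathbb{R}^{n-1}$). A finite subset of a Euclidean space is a two-distance set if exactly two distinct values occur as Euclidean distances between distinct points of it. -}

module Defs where

open import Level using (0ℓ)
open import Algebra.Bundles using (CommutativeRing)
open import Algebra.Core using (Op₁; Op₂)
open import Algebra.Definitions using (Congruent₁)
open import Algebra.Structures using (IsCommutativeRing)
open import Data.Bool.Base using (if_then_else_)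
open import Data.Empty using (⊥-elim)
open import Data.Fin.Base using (Fin; toℕ; fromℕ; inject₁)
open import Data.Fin.Permutation using (Permutation′; _⟨$⟩ʳ_)
open import Data.List.Base using (List; []; _∷_; length)
open import Data.List.Relation.Unary.Any using (Any)
open import Data.Nat.Base as ℕ using (ℕ; zero; suc; _<ᵇ_)
open import Data.Product.Base using (Σ; ∃; _×_; _,_; proj₁; proj₂)
open import Data.Sign.Base using (Sign) renaming (+ to ⊕; - to ⊖)
open import Data.Sum.Base using (_⊎_; inj₁; inj₂)
open import Data.Unit.Base using (⊤)
open import Data.Vec.Functional using (Vector)
open import Function.Bundles using (_⇔_)
open import Relation.Binary.Core using (Rel)
open import Relation.Binary.PropositionalEquality.Core using (_≡_)
open import Relation.Binary.Structures using (IsDecTotalOrder)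
open import Relation.Nullary using (¬_; yes; no)
open import Relation.Unary using (Pred; _∈_; _≐_; Satisfiable)
import Algebra.Definitions.RawMonoid as RawMonoidDefs
import Algebra.Properties.Ring as RingProperties
import Algebra.Solver.Ring.NaturalCoefficients.Default as SemiringSolver
import Data.List.Membership.Setoid as SetoidMembership
import Data.List.Relation.Unary.Unique.Setoid as SetoidUnique
import Data.Vec.Functional.Relation.Binary.Equality.Setoid as VectorEquality

-- The real numbers, given axiomatically: a Dedekind-complete ordered field is
-- unique up to isomorphism.  The reals are meant classically, so equality
-- and order are decidable; given excluded middle, the Cauchy reals with their
-- setoid equality are an instance.  The value of 0# ⁻¹ is unspecified.
record CompleteOrderedField : Set₁ where
  infix  9 _⁻¹
  infix  8 -_
  infixl 7 _*_
  infixl 6 _+_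
  infix  4 _≈_ _≤_
  field
    Carrier           : Set
    _≈_ _≤_           : Rel Carrier 0ℓ
    _+_ _*_           : Op₂ Carrier
    -_ _⁻¹            : Op₁ Carrier
    0# 1#             : Carrier
    isCommutativeRing : IsCommutativeRing _≈_ _+_ _*_ -_ 0# 1#
    0#≉1#             : ¬ (0# ≈ 1#)
    ⁻¹-cong           : Congruent₁ _≈_ _⁻¹
    ⁻¹-inverseʳ       : ∀ x → ¬ (x ≈ 0#) → x * x ⁻¹ ≈ 1#
    isDecTotalOrder   : IsDecTotalOrder _≈_ _≤_
    +-monoˡ-≤         : ∀ z {x y} → x ≤ y → x + z ≤ y + z
    *-nonNegative     : ∀ {x y} → 0# ≤ x → 0# ≤ y → 0# ≤ x * y

  UpperBound : Pred Carrier 0ℓ → Pred Carrier 0ℓ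
  UpperBound P b = ∀ x → P x → x ≤ b

  field
    supremum : ∀ P → Satisfiable P → Satisfiable (UpperBound P) →
               ∃ λ s → UpperBound P s × (∀ b → UpperBound P b → s ≤ b)

module RealArithmetic (ℛ : CompleteOrderedField) where

  open CompleteOrderedField ℛ public using (supremum; UpperBound)
  open CompleteOrderedField ℛ
    using (isCommutativeRing; 0#≉1#; ⁻¹-cong; ⁻¹-inverseʳ; isDecTotalOrder;
           +-monoˡ-≤; *-nonNegative; _⁻¹; _≤_)

  commutativeRing : CommutativeRing 0ℓ 0ℓ
  commutativeRing = record { isCommutativeRing = isCommutativeRing }

  open CommutativeRing commutativeRing public
    using (_≈_; _≉_; _+_; _*_; -_; _-_; 0#; 1#; setoid)
    renaming (Carrier to ℝ)
  open RawMonoidDefs (CommutativeRing.+-rawMonoid commutativeRing) public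
    using (sum) renaming (_×_ to _·_)

  infixl 7 _/_
  _/_ : Op₂ ℝ
  x / y = x * y ⁻¹

  ι : ℕ → ℝ
  ι k = k · 1#

  -- The square root as a supremum; the first alternative only matters for
  -- negative x, where it makes √ x ≈ 0#.
  SquareBelow : ℝ → Pred ℝ 0ℓ
  SquareBelow x y = y ≈ 0# ⊎ y * y ≤ x

  private
    module R = CommutativeRing commutativeRing
    module O = IsDecTotalOrder isDecTotalOrder
  open SemiringSolver R.commutativeSemiring using (solve; _:=_; _:+_; _:*_; con)

  module OrderLemmas where

    open RingProperties R.ring using (-‿distribˡ-*; -‿involutive; -‿distribʳ-*)

    +-mono : ∀ {a b c d} → a ≤ b → c ≤ d → a + c ≤ b + d
    +-mono {a} {b} {c} {d} a≤b c≤d = O.trans (+-monoˡ-≤ c a≤b)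
      (O.≤-respˡ-≈ (R.+-comm c b) (O.≤-respʳ-≈ (R.+-comm d b) (+-monoˡ-≤ b c≤d)))

    +-cancelʳ : ∀ {a b} z → a + z ≤ b + z → a ≤ b
    +-cancelʳ {a} {b} z p =
      O.≤-respˡ-≈ (cancel a) (O.≤-respʳ-≈ (cancel b) (+-monoˡ-≤ (- z) p))
      where
      cancel : ∀ x → x + z + - z ≈ x
      cancel x = R.trans (R.+-assoc x z (- z))
        (R.trans (R.+-congˡ (R.-‿inverseʳ z)) (R.+-identityʳ x))

    +-nonNeg : ∀ {a b} → 0# ≤ a → 0# ≤ b → 0# ≤ a + b
    +-nonNeg p q = O.≤-respˡ-≈ (R.+-identityˡ 0#) (+-mono p q)

    ≤-weaken : ∀ {a b c} → a + b ≈ c → 0# ≤ b → a ≤ c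
    ≤-weaken {a} e p =
      O.≤-respˡ-≈ (R.+-identityʳ a) (O.≤-respʳ-≈ e (+-mono O.refl p))

    *-monoˡ : ∀ {a b} w → 0# ≤ w → a ≤ b → a * w ≤ b * w
    *-monoˡ {a} {b} w 0≤w a≤b = ≤-weaken eq (*-nonNegative 0≤b-a 0≤w)
      where
      0≤b-a : 0# ≤ b + - a
      0≤b-a = O.≤-respˡ-≈ (R.-‿inverseʳ a) (+-monoˡ-≤ (- a) a≤b)
      eq : a * w + (b + - a) * w ≈ b * w
      eq = R.trans (R.sym (R.distribʳ w a (b + - a)))
        (R.*-congʳ (R.trans (R.+-comm a (b + - a))
          (R.trans (R.+-assoc b (- a) a)
            (R.trans (R.+-congˡ (R.-‿inverseˡ a)) (R.+-identityʳ b)))))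

    *-monoʳ : ∀ {a b} w → 0# ≤ w → a ≤ b → w * a ≤ w * b
    *-monoʳ {a} {b} w p q =
      O.≤-respˡ-≈ (R.*-comm a w) (O.≤-respʳ-≈ (R.*-comm b w) (*-monoˡ w p q))

    *-cancelʳ-≈ : ∀ {a b} w → w ≉ 0# → a * w ≈ b * w → a ≈ b
    *-cancelʳ-≈ {a} {b} w w≉0 e =
      R.trans (R.sym (cancel a)) (R.trans (R.*-congʳ e) (cancel b))
      where
      cancel : ∀ x → x * w * w ⁻¹ ≈ x
      cancel x = R.trans (R.*-assoc x w (w ⁻¹))
        (R.trans (R.*-congˡ (⁻¹-inverseʳ w w≉0)) (R.*-identityʳ x))

    *-cancelʳ-≤ : ∀ {a b} w → w ≉ 0# → 0# ≤ w → a * w ≤ b * w → a ≤ b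
    *-cancelʳ-≤ {a} {b} w w≉0 0≤w p with O.total a b
    ... | inj₁ a≤b = a≤b
    ... | inj₂ b≤a =
      O.reflexive (*-cancelʳ-≈ w w≉0 (O.antisym p (*-monoˡ w 0≤w b≤a)))

    square-nonNeg : ∀ y → 0# ≤ y * y
    square-nonNeg y with O.total 0# y
    ... | inj₁ 0≤y = *-nonNegative 0≤y 0≤y
    ... | inj₂ y≤0 = O.≤-respʳ-≈ eq (*-nonNegative 0≤-y 0≤-y)
      where
      0≤-y : 0# ≤ - y
      0≤-y = O.≤-respˡ-≈ (R.-‿inverseʳ y)
        (O.≤-respʳ-≈ (R.+-identityˡ (- y)) (+-monoˡ-≤ (- y) y≤0))
      eq : - y * - y ≈ y * y
      eq = R.trans (R.sym (-‿distribˡ-* y (- y)))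
        (R.trans (R.-‿cong (R.sym (-‿distribʳ-* y y))) (-‿involutive (y * y)))

    square-cancel : ∀ {y b} → 0# ≤ b → y * y ≤ b * b → y ≤ b
    square-cancel {y} {b} 0≤b p with O.total y b
    ... | inj₁ y≤b = y≤b
    ... | inj₂ b≤y with y O.≟ 0#
    ...   | yes y≈0 = O.≤-respˡ-≈ (R.sym y≈0) 0≤b
    ...   | no  y≉0 = *-cancelʳ-≤ y y≉0 0≤y (O.trans p (*-monoʳ b 0≤b b≤y))
      where
      0≤y = O.trans 0≤b b≤y

    0≤1 : 0# ≤ 1#
    0≤1 = O.≤-respʳ-≈ (R.*-identityˡ 1#) (square-nonNeg 1#)

    bounded : ∀ x → Satisfiable (UpperBound (SquareBelow x))
    bounded x with 0# O.≤? x
    ... | no  0≰x = 0# , λ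
      { y (inj₁ y≈0) → O.reflexive y≈0
      ; y (inj₂ yy≤x) → ⊥-elim (0≰x (O.trans (square-nonNeg y) yy≤x)) }
    ... | yes 0≤x = x + 1# , λ
      { y (inj₁ y≈0) → O.≤-respˡ-≈ (R.sym y≈0) (+-nonNeg 0≤x 0≤1)
      ; y (inj₂ yy≤x) → square-cancel (+-nonNeg 0≤x 0≤1)
          (O.trans yy≤x (≤-weaken (eq x)
            (+-nonNeg (+-nonNeg (square-nonNeg x) 0≤x) 0≤1))) }
      where
      eq : ∀ x → x + (x * x + x + 1#) ≈ (x + 1#) * (x + 1#)
      eq = solve 1 (λ x → x :+ (x :* x :+ x :+ con 1) :=
                          (x :+ con 1) :* (x :+ con 1)) R.refl

  open OrderLemmas

  √-supremum : ∀ x → ∃ λ s → UpperBound (SquareBelow x) s ×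
                             (∀ b → UpperBound (SquareBelow x) b → s ≤ b)
  √-supremum x = supremum (SquareBelow x) (0# , inj₁ R.refl) (bounded x)

  √ : Op₁ ℝ
  √ x = proj₁ (√-supremum x)

  √-nonNegative : ∀ x → 0# ≤ √ x
  √-nonNegative x = proj₁ (proj₂ (√-supremum x)) 0# (inj₁ R.refl)

  √-square : ∀ {x} → 0# ≤ x → √ x * √ x ≈ x
  √-square {x} 0≤x = O.antisym ss≤x x≤ss
    where
    s = √ x
    c = x + 1#
    w = s + c
    e = x * x + x + 1#
    N = c * s + x
    -- u lies on the same side of √ x as s, and u - s has the sign of
    -- x - s * s.
    u = N / w

    0≤s = √-nonNegative x
    0≤c = +-nonNeg 0≤x 0≤1
    0≤w = +-nonNeg 0≤s 0≤c
    0≤e = +-nonNeg (+-nonNeg (square-nonNeg x) 0≤x) 0≤1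

    w≉0 : w ≉ 0#
    w≉0 w≈0 = 0#≉1# (O.antisym 0≤1 (O.≤-respʳ-≈ w≈0
      (≤-weaken (R.trans (R.+-comm 1# (s + x)) (R.+-assoc s x 1#))
        (+-nonNeg 0≤s 0≤x))))

    ww≉0 : w * w ≉ 0#
    ww≉0 ww≈0 = w≉0 (*-cancelʳ-≈ w w≉0 (R.trans ww≈0 (R.sym (R.zeroˡ w))))

    uw : u * w ≈ N
    uw = R.trans (R.*-assoc N (w ⁻¹) w) (R.trans
      (R.*-congˡ (R.trans (R.*-comm (w ⁻¹) w) (⁻¹-inverseʳ w w≉0)))
      (R.*-identityʳ N))

    uuww : u * u * (w * w) ≈ N * N
    uuww = R.trans
      (solve 2 (λ u w → u :* u :* (w :* w) := (u :* w) :* (u :* w)) R.refl u w)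
      (R.*-cong uw uw)

    0≤u : 0# ≤ u
    0≤u = *-cancelʳ-≤ w w≉0 0≤w (O.≤-respˡ-≈ (R.sym (R.zeroˡ w))
      (O.≤-respʳ-≈ (R.sym uw) (+-nonNeg (*-nonNegative 0≤c 0≤s) 0≤x)))

    key : N * N + e * x ≈ x * (w * w) + e * (s * s)
    key = solve 2 (λ s x →
      ((x :+ con 1) :* s :+ x) :* ((x :+ con 1) :* s :+ x)
        :+ (x :* x :+ x :+ con 1) :* x :=
      x :* ((s :+ (x :+ con 1)) :* (s :+ (x :+ con 1)))
        :+ (x :* x :+ x :+ con 1) :* (s :* s)) R.refl s x

    sw : s * w ≈ s * s + c * s
    sw = R.trans (R.distribˡ s s c) (R.+-congˡ (R.*-comm s c))

    N′ : N ≈ x + c * s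
    N′ = R.+-comm (c * s) x

    lower : s * s ≤ x → x ≤ s * s
    lower ss≤x = +-cancelʳ (c * s) (O.≤-respˡ-≈ (R.trans uw N′)
      (O.≤-respʳ-≈ sw (*-monoˡ w 0≤w u≤s)))
      where
      NN≤xww : N * N ≤ x * (w * w)
      NN≤xww = +-cancelʳ (e * x) (O.≤-respˡ-≈ (R.sym key)
        (+-mono O.refl (*-monoʳ e 0≤e ss≤x)))
      uu≤x : u * u ≤ x
      uu≤x = *-cancelʳ-≤ (w * w) ww≉0 (square-nonNeg w)
        (O.≤-respˡ-≈ (R.sym uuww) NN≤xww)
      u≤s : u ≤ s
      u≤s = proj₁ (proj₂ (√-supremum x)) u (inj₂ uu≤x)

    upper : x ≤ s * s → s * s ≤ x
    upper x≤ss = +-cancelʳ (c * s) (O.≤-respʳ-≈ (R.trans uw N′)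
      (O.≤-respˡ-≈ sw (*-monoˡ w 0≤w s≤u)))
      where
      xww≤NN : x * (w * w) ≤ N * N
      xww≤NN = +-cancelʳ (e * x) (O.≤-respʳ-≈ (R.sym key)
        (+-mono O.refl (*-monoʳ e 0≤e x≤ss)))
      x≤uu : x ≤ u * u
      x≤uu = *-cancelʳ-≤ (w * w) ww≉0 (square-nonNeg w)
        (O.≤-respʳ-≈ (R.sym uuww) xww≤NN)
      s≤u : s ≤ u
      s≤u = proj₂ (proj₂ (√-supremum x)) u λ
        { y (inj₁ y≈0) → O.≤-respˡ-≈ (R.sym y≈0) 0≤u
        ; y (inj₂ yy≤x) → square-cancel 0≤u (O.trans yy≤x x≤uu) }

    ss≤x : s * s ≤ x
    ss≤x with O.total (s * s) x
    ... | inj₁ p = p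
    ... | inj₂ p = upper p

    x≤ss : x ≤ s * s
    x≤ss = lower ss≤x

module EuclideanSpace (ℛ : CompleteOrderedField) (d : ℕ) where

  open RealArithmetic ℛ
  open VectorEquality setoid public using (_≋_; ≋-setoid)

  Point : Set
  Point = Vector ℝ d

  PointSet : Set₁
  PointSet = Pred Point 0ℓ

  dist : Point → Point → ℝ
  dist x y = √ (sum λ i → (x i - y i) * (x i - y i))

  ⟦_⟧ : Point → PointSet
  ⟦ x ⟧ y = y ≋ x

  open SetoidMembership (≋-setoid d) using () renaming (_∈_ to _∈ₗ_)
  open SetoidUnique (≋-setoid d) using (Unique)

  Enumerates : List Point → PointSet → Set
  Enumerates xs A = ∀ x → x ∈ A ⇔ x ∈ₗ xs

  Finite : PointSet → Set
  Finite A = ∃ λ xs → Enumerates xs A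

  HasCardinality : PointSet → ℕ → Set
  HasCardinality A k = ∃ λ xs → Enumerates xs A × Unique xs × length xs ≡ k

  OccursAsDistance : PointSet → ℝ → Set
  OccursAsDistance A r =
    ∃ λ x → ∃ λ y → x ∈ A × y ∈ A × ¬ (x ≋ y) × dist x y ≈ r

  TwoDistance : PointSet → Set
  TwoDistance A = Finite A × ∃ λ r₁ → ∃ λ r₂ →
    r₁ ≉ r₂ × OccursAsDistance A r₁ × OccursAsDistance A r₂ ×
    (∀ r → OccursAsDistance A r → r ≈ r₁ ⊎ r ≈ r₂)

-- x1 s, …, x4 s name the sets X₁^s, …, X₄^s; ⊕ is the upper sign and ⊖ the
-- lower sign.
data Name : Set where
  x1 x2 x3 x4 : Sign → Name

Present : ℕ → Name → Set
Present n (x4 _) = n ℕ.≤ 10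
Present n _      = ⊤

-- The listed unions for each n, with the number of vectors after adding J̃′.
listed : ℕ → List (List Name × ℕ)
listed 5  = ((x1 ⊕ ∷ x1 ⊖ ∷ []) , 8) ∷ []
listed 6  = ((x1 ⊕ ∷ x4 ⊖ ∷ []) , 16) ∷ ((x1 ⊖ ∷ x4 ⊕ ∷ []) , 16) ∷ []
listed 7  = ((x4 ⊕ ∷ x4 ⊖ ∷ []) , 27) ∷ []
listed 8  = ((x2 ⊕ ∷ x4 ⊕ ∷ []) , 29) ∷ ((x2 ⊖ ∷ x4 ⊖ ∷ []) , 29) ∷ []
listed 9  = ((x1 ⊕ ∷ x1 ⊖ ∷ []) , 30) ∷ ((x1 ⊕ ∷ x3 ⊖ ∷ x4 ⊖ ∷ []) , 45)
          ∷ ((x1 ⊖ ∷ x3 ⊕ ∷ x4 ⊕ ∷ []) , 45) ∷ []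
listed 17 = ((x1 ⊕ ∷ x2 ⊖ ∷ []) , 122) ∷ ((x1 ⊖ ∷ x2 ⊕ ∷ []) , 122) ∷ []
listed _  = []

-- n = suc m, so that the first n − 1 coordinates are indexed by Fin m through
-- inject₁ and the last coordinate is fromℕ m.
module Construction (ℛ : CompleteOrderedField) (m : ℕ) where

  open RealArithmetic ℛ
  open EuclideanSpace ℛ (suc m) public

  n : ℕ
  n = suc m

  H : PointSet
  H x = sum x ≈ ι 2

  -- The vector (v , c): first n − 1 coordinates v, last coordinate c.
  HasCoordinates : Vector ℝ m → ℝ → PointSet
  HasCoordinates v c x = (∀ i → x (inject₁ i) ≈ v i) × x (fromℕ m) ≈ c

  -- The set (v , c)^P′.
  Permuted : Vector ℝ m → ℝ → PointSet
  Permuted v c x =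
    Σ (Permutation′ m) λ π → HasCoordinates (λ i → v (π ⟨$⟩ʳ i)) c x

  -- The n − 1 values (a^k , b^(n − 1 − k)), for k ≤ n − 1.
  block : ℝ → ℕ → ℝ → Vector ℝ m
  block a k b i = if toℕ i <ᵇ k then a else b

  J̃′ : PointSet
  J̃′ = Permuted (block 1# 2 0#) 0#

  infix 8 ±[_]_ ∓[_]_
  ±[_]_ ∓[_]_ : Sign → ℝ → ℝ
  ±[ ⊕ ] y = y
  ±[ ⊖ ] y = - y
  ∓[ ⊕ ] y = - y
  ∓[ ⊖ ] y = y

  X : Name → PointSet
  X = λ where
      (x1 s) → HasCoordinates
        (λ _ → (ι 2 * N + ±[ s ] (ι 2 * √ N)) / D)
        (∓[ s ] (ι 2 * √ N / N))
      (x2 s) → HasCoordinates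
        (λ _ → (ι 2 * N + ±[ s ] √ q₂) / D)
        (∓[ s ] (√ q₂ / N))
      (x3 s) → Permuted
        (block ((N + ±[ s ] 1#) / (N - 1#)) 1 ((1# + ±[ s ] 1#) / (N - 1#)))
        (∓[ s ] 1#)
      (x4 s) → Permuted
        (block ((ι 3 * N + ±[ s ] √ q₄) / D) (n ℕ.∸ 2)
               ((- (N * N) + ι 4 * N + ±[ s ] √ q₄) / D))
        (∓[ s ] (√ q₄ / N))
    where
    N  = ι n
    D  = N * (N - 1#)
    q₂ = ι 2 * (N * N) + ι 2 * N
    q₄ = ι 10 * N - N * N

  Distinct : Name → Name → Set
  Distinct a b = ¬ (X a ≐ X b)

  Union : List Name → PointSet
  Union S x = Any (λ a → x ∈ X a) S

{-# OPTIONS --safe #-}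

-- Up to the order of the first n - 1 coordinates, every vector of X₁, …, X₄ is
-- (c + α, c, …, c, t) with α ∈ {0, 1, -1}, and n t² = (2 - α)² + (n - 1) s for
-- an integer s.  If adding x to J̃′ keeps two distances, the sums x_k + x_l take
-- two values differing by 1; this forces that shape on x, and the distance to
-- one or two vectors of J̃′ then determines s.
--
-- (n - 1) times the squared distance between two such vectors is an integer
-- minus 2 n t t′, where n² t² t′² is an integer as well.  Hence a squared
-- distance equals w iff an integer quadratic equation in n holds and an
-- integer has the right sign.  For vectors of distinct sets this is impossible
-- when n ≥ 19, so that part (2) is a finite check.
module Submission where

open import Defs
open import Algebra.Bundles using (CommutativeRing)
open import Algebra.Properties.Monoid.Mult using (×-homo-+)
import Algebra.Properties.Monoid.Mult as MonoidMult
import Algebra.Properties.Monoid.Sum as MonoidSum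
import Algebra.Properties.Ring as RingProperties
import Algebra.Properties.Semiring.Mult as SemiringMult
import Algebra.Solver.Ring as RingSolver
open import Algebra.Solver.Ring.AlmostCommutativeRing
  using (fromCommutativeRing; _-Raw-AlmostCommutative⟶_)
open import Data.Bool.Base using (true; false; if_then_else_)
open import Data.Empty using (⊥-elim)
open import Data.Fin.Base as Fin using (Fin; zero; suc; toℕ; fromℕ; inject₁; punchOut)
open import Data.Fin.Permutation
  using (Permutation′; _⟨$⟩ʳ_; _⟨$⟩ˡ_; inverseˡ; inverseʳ; transpose; flip; insert)
  renaming (id to idₚ)
import Data.Fin.Properties as Finₚ
open import Data.Fin.Relation.Unary.Top using (‵fromℕ; ‵inj₁; view; view-fromℕ; view-inject₁)
import Data.Integer.Base as Int
open Int using (ℤ; +_; -[1+_]; 0ℤ; 1ℤ; -1ℤ)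
import Data.Integer.Properties as ℤₚ
import Data.Integer.Tactic.RingSolver as ℤSolver
open import Data.List.Base
  using (List; []; _∷_; _++_; allFin; cartesianProduct; concatMap; filter; length; map; upTo)
open import Data.List.Membership.Propositional using (find; lose) renaming (_∈_ to _∈ₗ_)
open import Data.List.Membership.Propositional.Properties
  using (∈-allFin; ∈-cartesianProduct⁺; ∈-filter⁺; ∈-upTo⁺)
open import Data.List.Properties using (length-++; length-map)
open import Data.List.Relation.Binary.Subset.Propositional using () renaming (_⊆_ to _⊆ₗ_)
open import Data.List.Relation.Unary.All as All using (All; []; _∷_)
import Data.List.Relation.Unary.All.Properties as Allₚ
open import Data.List.Relation.Unary.AllPairs as AllPairs using (AllPairs; []; _∷_)
import Data.List.Relation.Unary.AllPairs.Properties as AllPairsₚ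
open import Data.List.Relation.Unary.Any as Any using (Any; here; there)
import Data.List.Relation.Unary.Any.Properties as Anyₚ
open import Data.List.Relation.Unary.Unique.Propositional using (Unique)
open import Data.List.Relation.Unary.Unique.Propositional.Properties
  using (filter⁺; cartesianProduct⁺; allFin⁺)
open import Data.Maybe.Base using (nothing; just)
open import Data.Nat.Base as ℕ using (ℕ; zero; suc; _<ᵇ_)
import Data.Nat.ListAction as ListAction
import Data.Nat.Properties as ℕₚ
open import Data.Product.Base using (∃; _×_; _,_; proj₁; proj₂)
open import Data.Product.Properties using (≡-dec)
open import Data.Sign.Base using (Sign) renaming (+ to ⊕; - to ⊖)
import Data.Sign.Properties as Signₚ
open import Data.Sum.Base as Sum using (_⊎_; inj₁; inj₂; [_,_]′)
open import Data.Unit.Base using (tt)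
open import Data.Vec.Functional using (Vector)
open import Function.Base using (_∘_)
open import Function.Bundles using (_⇔_; mk⇔; mk↣; Equivalence)
open import Relation.Binary.Definitions using (DecidableEquality; Tri; tri<; tri≈; tri>)
open import Relation.Binary.PropositionalEquality as ≡ using (_≡_; _≢_; refl)
import Relation.Binary.Reasoning.Setoid
open import Relation.Binary.Structures using (IsDecTotalOrder)
open import Relation.Nullary using (¬_; Dec; yes; no; does; contradiction)
open import Relation.Nullary.Decidable
  using (_×-dec_; _⊎-dec_; _→-dec_; ¬?; decidable-stable; dec-false; dec-true; from-yes; via-injection)
open import Relation.Unary using (_∈_; _∉_; _∪_; _⊆_; _∖_; _≐_)

-- For `n ≥ 5` the set J̃′ contains pairs of vectors whose supports meet in one element and pairs
-- whose supports are disjoint, so both distances, √2 and √4, are fixed before anything is added.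
-- The condition on a union is then pairwise: any two vectors coincide or have squared distance 2 or
-- 4. For vectors of two named sets this depends, besides `n`, only on whether the exceptional
-- coordinates coincide, so the unions of part (2) are the cliques of a decidable relation on eight
-- names. The obstacle is the irrational product `t t′`; it is recovered from its square and its
-- sign, both of which are integer data. In the resulting quadratic equation the constant terms
-- cancel: a factor `n - 1` splits off and a factor of degree at most one in `n - 1` remains. Where
-- that factor vanishes identically, only the sign can exclude the distance. X₄ is absent from
-- `n = 11` on, so for large `n` only X₁, X₂ and X₃ are compared.

names : List Name
names = x1 ⊕ ∷ x1 ⊖ ∷ x2 ⊕ ∷ x2 ⊖ ∷ x3 ⊕ ∷ x3 ⊖ ∷ x4 ⊕ ∷ x4 ⊖ ∷ []

family : Name → ℕ × Sign
family (x1 s) = 1 , s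
family (x2 s) = 2 , s
family (x3 s) = 3 , s
family (x4 s) = 4 , s

family-injective : ∀ {a b} → family a ≡ family b → a ≡ b
family-injective {x1 _} {x1 _} refl = refl
family-injective {x2 _} {x2 _} refl = refl
family-injective {x3 _} {x3 _} refl = refl
family-injective {x4 _} {x4 _} refl = refl

_≟_ : DecidableEquality Name
_≟_ = via-injection (mk↣ family-injective) (≡-dec ℕₚ._≟_ Signₚ._≟_)


open import Data.List.Membership.DecPropositional _≟_ using (_∈?_)

∈-names : ∀ a → a ∈ₗ names
∈-names (x1 ⊕) = from-yes (x1 ⊕ ∈? names)
∈-names (x1 ⊖) = from-yes (x1 ⊖ ∈? names)
∈-names (x2 ⊕) = from-yes (x2 ⊕ ∈? names)
∈-names (x2 ⊖) = from-yes (x2 ⊖ ∈? names)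
∈-names (x3 ⊕) = from-yes (x3 ⊕ ∈? names)
∈-names (x3 ⊖) = from-yes (x3 ⊖ ∈? names)
∈-names (x4 ⊕) = from-yes (x4 ⊕ ∈? names)
∈-names (x4 ⊖) = from-yes (x4 ⊖ ∈? names)

present? : ∀ n a → Dec (Present n a)
present? n (x1 _) = yes tt
present? n (x2 _) = yes tt
present? n (x3 _) = yes tt
present? n (x4 _) = n ℕₚ.≤? 10

Present-anti : ∀ {n n′} a → n ℕ.≤ n′ → Present n′ a → Present n a
Present-anti (x1 _) _ _ = tt
Present-anti (x2 _) _ _ = tt
Present-anti (x3 _) _ _ = tt
Present-anti (x4 _) p q = ℕₚ.≤-trans p q

-- Integer criterion for the squared distance of two vectors

module _ where
  open Int hiding (suc)

  -- The vectors of X a are (c , … , c + α a , … , c , t); slope a is the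
  -- integer for which n t² = (2 - α a)² + (n - 1) slope a, and direction a is
  -- the sign of - t.
  α slope direction : Name → ℤ
  α (x1 _) = 0ℤ
  α (x2 _) = 0ℤ
  α (x3 _) = 1ℤ
  α (x4 _) = -1ℤ
  slope (x1 _) = 0ℤ
  slope (x2 _) = + 2
  slope (x3 _) = 1ℤ
  slope (x4 _) = -1ℤ
  direction a = signed (proj₂ (family a))
    where
    signed : Sign → ℤ
    signed ⊕ = 1ℤ
    signed ⊖ = -1ℤ

  height² : ℕ → Name → ℤ
  height² m a = (+ 2 - α a) * (+ 2 - α a) + slope a * + m

  -- The value that `2 n t t′` must take for the squared distance to be `w`: everything else in
  -- `(n - 1)` times the squared distance, less `(n - 1) w`.
  excess : ℕ → Name → Name → ℕ → ℕ → ℤ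
  excess m a b δ w = + m * (α a * α a + α b * α b - + 2 * (α a * α b * + δ) - + w)
    - (α a - α b) * (α a - α b) + height² m a + height² m b

  -- Two vectors of X a and X b, whose exceptional coordinates coincide iff
  -- δ = 1, have squared distance w.
  AtDistance : ℕ → Name → Name → ℕ → ℕ → Set
  AtDistance m a b δ w =
    + 4 * (height² m a * height² m b) ≡ excess m a b δ w * excess m a b δ w ×
    0ℤ ≤ direction a * direction b * excess m a b δ w

  base : Name → Name → ℤ
  base a b = + 2 * ((+ 2 - α a) * (+ 2 - α b))

  rate g₁ g₀ : Name → Name → ℕ → ℕ → ℤ
  rate a b δ w = α a * α a + α b * α b - + 2 * (α a * α b * + δ) - + w + slope a + slope b
  g₁ a b δ w = + 4 * (slope a * slope b) - rate a b δ w * rate a b δ w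
  g₀ a b δ w = + 4 * ((+ 2 - α a) * (+ 2 - α a) * slope b + slope a * ((+ 2 - α b) * (+ 2 - α b)))
    - + 2 * (base a b * rate a b δ w)

  excess-linear : ∀ m a b δ w → excess m a b δ w ≡ base a b + rate a b δ w * + m
  excess-linear m a b δ w = lemma (α a) (α b) (slope a) (slope b) (+ δ) (+ w) (+ m)
    where
    lemma : ∀ x y s t d w m →
      m * (x * x + y * y - + 2 * (x * y * d) - w) - (x - y) * (x - y)
        + ((+ 2 - x) * (+ 2 - x) + s * m) + ((+ 2 - y) * (+ 2 - y) + t * m)
      ≡ + 2 * ((+ 2 - x) * (+ 2 - y))
        + (x * x + y * y - + 2 * (x * y * d) - w + s + t) * m
    lemma = ℤSolver.solve-∀

  -- Heights and excess are affine in `m`, and the constant terms cancel because the square of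
  -- `base a b` is `4 (2 - α a)² (2 - α b)²`. Splitting off `m` leaves the coefficients `g₁` and
  -- `g₀`.
  discriminant : ∀ m a b δ w →
    + 4 * (height² m a * height² m b) - excess m a b δ w * excess m a b δ w
      ≡ + m * (g₁ a b δ w * + m + g₀ a b δ w)
  discriminant m a b δ w rewrite excess-linear m a b δ w =
    lemma (α a) (α b) (slope a) (slope b) (rate a b δ w) (+ m)
    where
    lemma : ∀ x y s t r m → let e = + 2 * ((+ 2 - x) * (+ 2 - y)) in
      + 4 * (((+ 2 - x) * (+ 2 - x) + s * m) * ((+ 2 - y) * (+ 2 - y) + t * m))
        - (e + r * m) * (e + r * m)
      ≡ m * ((+ 4 * (s * t) - r * r) * m
        + (+ 4 * ((+ 2 - x) * (+ 2 - x) * t + s * ((+ 2 - y) * (+ 2 - y))) - + 2 * (e * r)))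
    lemma = ℤSolver.solve-∀

  -- Reasons for which AtDistance m a b δ w fails for every m ≥ 18: the factor
  -- g₁ m + g₀ of the discriminant has no root m ≥ 18, or the excess has the
  -- wrong sign.
  Excluded : Name → Name → ℕ → ℕ → Set
  Excluded a b δ w =
    (∣ g₀ a b δ w ∣ ℕ.< ∣ g₁ a b δ w ∣ ℕ.* 18 ⊎ g₁ a b δ w ≡ 0ℤ × g₀ a b δ w ≢ 0ℤ) ⊎
    direction a * direction b * base a b < 0ℤ × direction a * direction b * rate a b δ w ≤ 0ℤ

  excluded? : ∀ a b δ w → Dec (Excluded a b δ w)
  excluded? a b δ w =
    ((∣ g₀ a b δ w ∣ ℕₚ.<? ∣ g₁ a b δ w ∣ ℕ.* 18) ⊎-dec
       ((g₁ a b δ w ℤₚ.≟ 0ℤ) ×-dec ¬? (g₀ a b δ w ℤₚ.≟ 0ℤ))) ⊎-dec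
    ((direction a * direction b * base a b ℤₚ.<? 0ℤ) ×-dec
       (direction a * direction b * rate a b δ w ℤₚ.≤? 0ℤ))

  -- A root would give `∣ h ∣ = ∣ g ∣ m ≥ 18 ∣ g ∣`; when `g` vanishes, what is left is the constant
  -- `h`.
  no-root : ∀ {m g h} → 18 ℕ.≤ m → ∣ h ∣ ℕ.< ∣ g ∣ ℕ.* 18 ⊎ g ≡ 0ℤ × h ≢ 0ℤ →
    g * + m + h ≢ 0ℤ
  no-root {m} {g} {h} 18≤m (inj₁ small) e = ℕₚ.<⇒≱ small (begin
    ∣ g ∣ ℕ.* 18   ≤⟨ ℕₚ.*-monoʳ-≤ ∣ g ∣ 18≤m ⟩
    ∣ g ∣ ℕ.* m    ≡⟨ ≡.sym (ℤₚ.abs-* g (+ m)) ⟩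
    ∣ g * + m ∣    ≡⟨ ≡.cong ∣_∣ (ℤₚ.i-j≡0⇒i≡j (g * + m) (- h)
                       (≡.trans (≡.cong (_+_ (g * + m)) (ℤₚ.neg-involutive h)) e)) ⟩
    ∣ - h ∣        ≡⟨ ℤₚ.∣-i∣≡∣i∣ h ⟩
    ∣ h ∣          ∎)
    where open ℕₚ.≤-Reasoning
  no-root {m} {h = h} _ (inj₂ (refl , h≢0)) e =
    h≢0 (≡.trans (≡.sym (ℤₚ.+-identityˡ h)) e)

  excluded : ∀ {m} a b δ w → 18 ℕ.≤ m → Excluded a b δ w → ¬ AtDistance m a b δ w
  excluded {ℕ.suc m} a b δ w 18≤m (inj₁ r) (eq , _) = no-root 18≤m r
    ([ (λ ()) , (λ z → z) ]′ (ℤₚ.i*j≡0⇒i≡0∨j≡0 (+ suc m) (≡.trans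
      (≡.sym (discriminant (suc m) a b δ w)) (ℤₚ.i≡j⇒i-j≡0 eq))))
  excluded {m} a b δ w 18≤m (inj₂ (e₀<0 , e₁≤0)) (_ , 0≤e) =
    ℤₚ.<⇒≱ (ℤₚ.+-mono-<-≤ e₀<0 (ℤₚ.*-monoʳ-≤-nonNeg (+ m) e₁≤0))
      (≡.subst (0ℤ ≤_) (≡.trans
        (≡.cong (σ *_) (excess-linear m a b δ w)) (lemma σ (base a b) (rate a b δ w) (+ m))) 0≤e)
    where
    σ = direction a * direction b
    lemma : ∀ s e r m → s * (e + r * m) ≡ s * e + s * r * m
    lemma = ℤSolver.solve-∀

-- Compatibility of named sets and its finite verification

atDistance? : ∀ m a b δ w → Dec (AtDistance m a b δ w)
atDistance? m a b δ w =
  (_ ℤₚ.≟ _) ×-dec (0ℤ ℤₚ.≤? _)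

-- Every vector of X a and every vector of X b are at a squared distance
-- belonging to ws.
Distances : List ℕ → ℕ → Name → Name → Set
Distances ws m a b = All (λ δ → Any (AtDistance m a b δ) ws) (0 ∷ 1 ∷ [])

-- Coincidence is allowed in the condition extracted from a two-distance union, since different
-- names may share vectors. The listed unions satisfy the stronger condition without 0, which also
-- makes their sets disjoint and so yields the cardinalities.
Compatible Apart : ℕ → Name → Name → Set
Compatible = Distances (0 ∷ 2 ∷ 4 ∷ [])
Apart      = Distances (2 ∷ 4 ∷ [])

distances? : ∀ ws m a b → Dec (Distances ws m a b)
distances? ws m a b = All.all? (λ δ → Any.any? (atDistance? m a b δ) ws) (0 ∷ 1 ∷ [])

compatible? : ∀ m a b → Dec (Compatible m a b)
compatible? = distances? (0 ∷ 2 ∷ 4 ∷ [])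

apart? : ∀ m a b → Dec (Apart m a b)
apart? = distances? (2 ∷ 4 ∷ [])

-- At `n = 10` the radicand of X₄ vanishes and both signs name one set; this exempts the pair from
-- being listed.
Both₄ : Name → Name → Set
Both₄ a b = proj₁ (family a) ≡ 4 × proj₁ (family b) ≡ 4

-- A compatible pair of distinct sets determines the listed union that contains
-- every set compatible with both.
Classified : ℕ → Name → Name → Set
Classified m a b = Present (suc m) a → Present (suc m) b → Compatible m a b →
  a ≡ b ⊎ (m ≡ 9 × Both₄ a b) ⊎
  Any (λ Mk → All (λ c → Present (suc m) c → Compatible m c a → Compatible m c b →
                     c ∈ₗ proj₁ Mk) names) (listed (suc m))

classified? : ∀ m a b → Dec (Classified m a b)
classified? m a b =
  present? (suc m) a →-dec present? (suc m) b →-dec compatible? m a b →-dec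
  ((a ≟ b) ⊎-dec ((m ℕₚ.≟ 9) ×-dec (_ ℕₚ.≟ _) ×-dec (_ ℕₚ.≟ _)) ⊎-dec
  Any.any? (λ Mk → All.all? (λ c → present? (suc m) c →-dec compatible? m c a →-dec
    compatible? m c b →-dec (c ∈? proj₁ Mk)) names) (listed (suc m)))

pairs : ∀ d → List (Fin d × Fin d)
pairs d = filter (λ (i , j) → i Finₚ.<? j) (cartesianProduct (allFin d) (allFin d))

-- The positions of the exceptional coordinate; the vectors of X (x1 s) and
-- X (x2 s) have none, and are indexed by zero.
positions : ∀ d → Name → List (Fin (suc d))
positions d (x1 _) = zero ∷ []
positions d (x2 _) = zero ∷ []
positions d (x3 _) = allFin (suc d)
positions d (x4 _) = allFin (suc d)

size : ℕ → List Name → ℕ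
size d S = length (pairs (suc d)) ℕ.+ ListAction.sum (map (λ a → length (positions d a)) S)

Sound : ℕ → List Name × ℕ → Set
Sound d (S , c) = All (Present (2 ℕ.+ d)) S × AllPairs (Apart (suc d)) S × size d S ≡ c

sound? : ∀ d Mk → Dec (Sound d Mk)
sound? d (S , c) = All.all? (present? (2 ℕ.+ d)) S ×-dec
  AllPairs.allPairs? (apart? (suc d)) S ×-dec (size d S ℕₚ.≟ c)

-- Unfolding these proofs by accident is prohibitively expensive.
abstract

  -- The 14 values of `k` are `n = 5, …, 18`; from `n = 19` on the exclusion by degree and sign
  -- takes over.
  classified-small : All (λ k → All (λ a → All (Classified (4 ℕ.+ k) a) names) names) (upTo 14)
  classified-small = from-yes (All.all? (λ k →
    All.all? (λ a → All.all? (classified? (4 ℕ.+ k) a) names) names) (upTo 14))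

  -- A single `δ` for which 0, 2 and 4 are all excluded refutes compatibility. Presence is tested at
  -- 19 because it is inherited by smaller `n`; this disposes of X₄ for every larger `n`.
  incompatible-large : All (λ a → All (λ b → Present 19 a → Present 19 b →
    a ≡ b ⊎ Any (λ δ → All (Excluded a b δ) (0 ∷ 2 ∷ 4 ∷ [])) (0 ∷ 1 ∷ [])) names) names
  incompatible-large = from-yes (All.all? (λ a → All.all? (λ b →
    present? 19 a →-dec present? 19 b →-dec
    ((a ≟ b) ⊎-dec Any.any? (λ δ → All.all? (excluded? a b δ) (0 ∷ 2 ∷ 4 ∷ [])) (0 ∷ 1 ∷ [])))
    names) names)

  listed-sound-small : All (λ k → All (Sound (3 ℕ.+ k)) (listed (5 ℕ.+ k))) (upTo 14)
  listed-sound-small = from-yes (All.all? (λ k →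
    All.all? (sound? (3 ℕ.+ k)) (listed (5 ℕ.+ k))) (upTo 14))

excluded-all : ∀ {m} a b δ ws → 18 ℕ.≤ m → All (Excluded a b δ) ws → ¬ Any (AtDistance m a b δ) ws
excluded-all a b δ (w ∷ _)  18≤m (e ∷ _)  (here d)  = excluded a b δ w 18≤m e d
excluded-all a b δ (_ ∷ ws) 18≤m (_ ∷ es) (there d) = excluded-all a b δ ws 18≤m es d

incompatible : ∀ {m} a b δs ws → 18 ℕ.≤ m → Any (λ δ → All (Excluded a b δ) ws) δs →
  ¬ All (λ δ → Any (AtDistance m a b δ) ws) δs
incompatible a b (δ ∷ _)  ws 18≤m (here e)  (d ∷ _)  = excluded-all a b δ ws 18≤m e d
incompatible a b (_ ∷ δs) ws 18≤m (there e) (_ ∷ ds) = incompatible a b δs ws 18≤m e ds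

compatible-large : ∀ m a b → 18 ℕ.≤ m → Present (suc m) a → Present (suc m) b →
  Compatible m a b → a ≡ b
compatible-large m a b 18≤m pa pb c =
  [ (λ e → e) , (λ e → ⊥-elim (incompatible a b (0 ∷ 1 ∷ []) (0 ∷ 2 ∷ 4 ∷ []) 18≤m e c)) ]′
    (All.lookup (All.lookup incompatible-large (∈-names a)) (∈-names b)
      (Present-anti a (ℕ.s≤s 18≤m) pa) (Present-anti b (ℕ.s≤s 18≤m) pb))

upTo-or-beyond : ∀ (P : ℕ → Set) b → All P (upTo b) → (∀ k → P (b ℕ.+ k)) → ∀ k → P k
upTo-or-beyond P b small large k with k ℕₚ.<? b
... | yes k<b = All.lookup small (∈-upTo⁺ k<b)
... | no  k≮b = ≡.subst P (ℕₚ.m+[n∸m]≡n (ℕₚ.≮⇒≥ k≮b)) (large (k ℕ.∸ b))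

classified : ∀ k a b → Classified (4 ℕ.+ k) a b
classified k a b = upTo-or-beyond (λ k → Classified (4 ℕ.+ k) a b) 14
  (All.map (λ c → All.lookup (All.lookup c (∈-names a)) (∈-names b)) classified-small)
  (λ l pa pb c → inj₁ (compatible-large (18 ℕ.+ l) a b (ℕₚ.m≤m+n 18 l) pa pb c)) k

listed-sound : ∀ k → All (Sound (3 ℕ.+ k)) (listed (5 ℕ.+ k))
listed-sound = upTo-or-beyond (λ k → All (Sound (3 ℕ.+ k)) (listed (5 ℕ.+ k))) 14
  -- From `n = 19` on `listed` reduces to the empty list.
  listed-sound-small (λ _ → [])

-- Integers, order and square roots in the real field

module RealProperties (ℛ : CompleteOrderedField) where

  open RealArithmetic ℛ public
  open OrderLemmas public
  open CompleteOrderedField ℛ public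
    using (0#≉1#; ⁻¹-inverseʳ; _⁻¹; _≤_; *-nonNegative)
  module R = CommutativeRing commutativeRing
  module O = IsDecTotalOrder (CompleteOrderedField.isDecTotalOrder ℛ)
  open RingProperties R.ring public
    using (-‿distribˡ-*; -‿distribʳ-*; -‿involutive; -‿+-comm; -0#≈0#)
  open SemiringMult R.semiring using (×1-homo-*)
  open Relation.Binary.Reasoning.Setoid setoid public

  ι-+ : ∀ a b → ι (a ℕ.+ b) ≈ ι a + ι b
  ι-+ = ×-homo-+ R.+-monoid 1#

  ⟦_⟧ : ℤ → ℝ
  ⟦ + k ⟧      = ι k
  ⟦ -[1+ k ] ⟧ = - ι (suc k)

  ⟦⟧-⊖ : ∀ a b → ⟦ a Int.⊖ b ⟧ ≈ ι a - ι b
  ⟦⟧-⊖ a b with ℕₚ.≤-total b a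
  ... | inj₁ b≤a = begin
    ⟦ a Int.⊖ b ⟧                      ≡⟨ ≡.cong ⟦_⟧ (ℤₚ.⊖-≥ b≤a) ⟩
    ι (a ℕ.∸ b)                    ≈⟨ R.sym (R.+-identityʳ _) ⟩
    ι (a ℕ.∸ b) + 0#               ≈⟨ R.+-congˡ (R.sym (R.-‿inverseʳ _)) ⟩
    ι (a ℕ.∸ b) + (ι b - ι b)      ≈⟨ R.sym (R.+-assoc _ _ _) ⟩
    ι (a ℕ.∸ b) + ι b - ι b        ≈⟨ R.+-congʳ (R.sym (ι-+ (a ℕ.∸ b) b)) ⟩
    ι (a ℕ.∸ b ℕ.+ b) - ι b        ≡⟨ ≡.cong (λ c → ι c - ι b) (ℕₚ.m∸n+n≡m b≤a) ⟩
    ι a - ι b                      ∎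
  ... | inj₂ a≤b = begin
    ⟦ a Int.⊖ b ⟧                      ≡⟨ ≡.cong ⟦_⟧ (ℤₚ.⊖-≤ a≤b) ⟩
    ⟦ Int.- + (b ℕ.∸ a) ⟧            ≈⟨ neg (b ℕ.∸ a) ⟩
    - ι (b ℕ.∸ a)                  ≈⟨ R.sym (R.+-identityˡ _) ⟩
    0# - ι (b ℕ.∸ a)               ≈⟨ R.+-congʳ (R.sym (R.-‿inverseʳ _)) ⟩
    ι a - ι a - ι (b ℕ.∸ a)        ≈⟨ R.+-assoc _ _ _ ⟩
    ι a + (- ι a - ι (b ℕ.∸ a))    ≈⟨ R.+-congˡ (-‿+-comm _ _) ⟩
    ι a - (ι a + ι (b ℕ.∸ a))      ≈⟨ R.+-congˡ (R.-‿cong (R.sym (ι-+ a (b ℕ.∸ a)))) ⟩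
    ι a - ι (a ℕ.+ (b ℕ.∸ a))      ≡⟨ ≡.cong (λ c → ι a - ι c) (ℕₚ.m+[n∸m]≡n a≤b) ⟩
    ι a - ι b                      ∎
    where
    neg : ∀ c → ⟦ Int.- + c ⟧ ≈ - ι c
    neg zero    = R.sym -0#≈0#
    neg (suc c) = R.refl

  ⟦⟧-neg : ∀ a → ⟦ Int.- a ⟧ ≈ - ⟦ a ⟧
  ⟦⟧-neg (+ zero)  = R.sym -0#≈0#
  ⟦⟧-neg (+ suc a) = R.refl
  ⟦⟧-neg -[1+ a ]  = R.sym (-‿involutive _)

  ⟦⟧-+ : ∀ a b → ⟦ a Int.+ b ⟧ ≈ ⟦ a ⟧ + ⟦ b ⟧
  ⟦⟧-+ (+ a) (+ b)       = ι-+ a b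
  ⟦⟧-+ (+ a) -[1+ b ]    = ⟦⟧-⊖ a (suc b)
  ⟦⟧-+ -[1+ a ] (+ b)    = R.trans (⟦⟧-⊖ b (suc a)) (R.+-comm _ _)
  ⟦⟧-+ -[1+ a ] -[1+ b ] = begin
    - ι (suc (suc (a ℕ.+ b)))  ≡⟨ ≡.cong (λ c → - ι (suc c)) (≡.sym (ℕₚ.+-suc a b)) ⟩
    - ι (suc a ℕ.+ suc b)      ≈⟨ R.-‿cong (ι-+ (suc a) (suc b)) ⟩
    - (ι (suc a) + ι (suc b))  ≈⟨ R.sym (-‿+-comm _ _) ⟩
    - ι (suc a) - ι (suc b)    ∎

  ⟦⟧-*-pos : ∀ a b → ⟦ + a Int.* b ⟧ ≈ ι a * ⟦ b ⟧
  ⟦⟧-*-pos a (+ b)    = R.trans (R.reflexive (≡.cong ⟦_⟧ (≡.sym (ℤₚ.pos-* a b)))) (×1-homo-* a b)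
  ⟦⟧-*-pos a -[1+ b ] = begin
    ⟦ + a Int.* -[1+ b ] ⟧      ≡⟨ ≡.cong ⟦_⟧ (≡.sym (ℤₚ.neg-distribʳ-* (+ a) (+ suc b))) ⟩
    ⟦ Int.- (+ a Int.* + suc b) ⟧ ≈⟨ ⟦⟧-neg (+ a Int.* + suc b) ⟩
    - ⟦ + a Int.* + suc b ⟧     ≈⟨ R.-‿cong (⟦⟧-*-pos a (+ suc b)) ⟩
    - (ι a * ι (suc b))       ≈⟨ -‿distribʳ-* _ _ ⟩
    ι a * - ι (suc b)         ∎

  ⟦⟧-* : ∀ a b → ⟦ a Int.* b ⟧ ≈ ⟦ a ⟧ * ⟦ b ⟧
  ⟦⟧-* (+ a)    b = ⟦⟧-*-pos a b
  ⟦⟧-* -[1+ a ] b = begin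
    ⟦ -[1+ a ] Int.* b ⟧        ≡⟨ ≡.cong ⟦_⟧ (≡.sym (ℤₚ.neg-distribˡ-* (+ suc a) b)) ⟩
    ⟦ Int.- (+ suc a Int.* b) ⟧   ≈⟨ ⟦⟧-neg (+ suc a Int.* b) ⟩
    - ⟦ + suc a Int.* b ⟧       ≈⟨ R.-‿cong (⟦⟧-*-pos (suc a) b) ⟩
    - (ι (suc a) * ⟦ b ⟧)     ≈⟨ -‿distribˡ-* _ _ ⟩
    - ι (suc a) * ⟦ b ⟧       ∎

  -- With coefficients in ℤ, whose equality is decidable, the ring solver computes with numerals
  -- such as `ι 4` instead of treating them as atoms.
  ⟦⟧-morphism : Int.+-*-rawRing -Raw-AlmostCommutative⟶ fromCommutativeRing commutativeRing
  ⟦⟧-morphism = record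
    { ⟦_⟧ = ⟦_⟧ ; +-homo = ⟦⟧-+ ; *-homo = ⟦⟧-* ; -‿homo = ⟦⟧-neg
    ; 0-homo = R.refl ; 1-homo = R.+-identityʳ 1# }

  coeff≟ : ∀ a b → _
  coeff≟ a b with a ℤₚ.≟ b
  ... | yes a≡b = just (R.reflexive (≡.cong ⟦_⟧ a≡b))
  ... | no  _   = nothing

  open RingSolver Int.+-*-rawRing (fromCommutativeRing commutativeRing) ⟦⟧-morphism coeff≟ public
    using (Polynomial; solve; _:=_; con; _:+_; _:*_; _:-_; :-_; _:^_)

  -- Evaluates to 1# itself, whereas con 1ℤ evaluates to 1# + 0#.
  :1 : ∀ {k} → Polynomial k
  :1 = con 0ℤ :^ 0

  :ι : ∀ {k} → ℕ → Polynomial k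
  :ι c = con (+ c)


  -- For c - d and a - b equal as polynomials, the second premise is a ring
  -- identity.
  move : ∀ {a b c d} → a ≈ b → c + b ≈ d + a → c ≈ d
  move {a} {b} {c} {d} a≈b e = begin
    c          ≈⟨ solve 2 (λ a c → c := c :+ a :- a) R.refl a c ⟩
    c + a - a  ≈⟨ R.+-congʳ (R.trans (R.+-congˡ a≈b) e) ⟩
    d + a - a  ≈⟨ solve 2 (λ a d → d :+ a :- a := d) R.refl a d ⟩
    d          ∎

  0≤ι : ∀ k → 0# ≤ ι k
  0≤ι zero    = O.refl
  0≤ι (suc k) = +-nonNeg 0≤1 (0≤ι k)

  -- An ordered field has characteristic zero, as `1 ≤ 1 + ι k`. This is what allows equations
  -- between integers to be reflected from the reals back to ℤ.
  ι-suc≉0 : ∀ k → ι (suc k) ≉ 0#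
  ι-suc≉0 k e = 0#≉1# (O.antisym 0≤1 (O.≤-respʳ-≈ e (≤-weaken R.refl (0≤ι k))))

  ⟦⟧-injective : ∀ {a} → ⟦ a ⟧ ≈ 0# → a ≡ 0ℤ
  ⟦⟧-injective {+ zero}   e = ≡.refl
  ⟦⟧-injective {+ suc a}  e = ⊥-elim (ι-suc≉0 a e)
  ⟦⟧-injective { -[1+ a ]} e = ⊥-elim (ι-suc≉0 a
    (R.trans (R.sym (-‿involutive _)) (R.trans (R.-‿cong e) -0#≈0#)))

  ⟦⟧-cancel : ∀ {a b} → ⟦ a ⟧ ≈ ⟦ b ⟧ → a ≡ b
  ⟦⟧-cancel {a} {b} e = ℤₚ.i-j≡0⇒i≡j a b (⟦⟧-injective (begin
    ⟦ a Int.- b ⟧          ≈⟨ ⟦⟧-+ a (Int.- b) ⟩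
    ⟦ a ⟧ + ⟦ Int.- b ⟧    ≈⟨ R.+-cong e (⟦⟧-neg b) ⟩
    ⟦ b ⟧ - ⟦ b ⟧        ≈⟨ R.-‿inverseʳ _ ⟩
    0#                   ∎))

  neg-nonPos : ∀ {x} → 0# ≤ - x → x ≤ 0#
  neg-nonPos {x} p = ≤-weaken (R.-‿inverseʳ x) p

  ⟦⟧-nonNeg⁻¹ : ∀ {a} → 0# ≤ ⟦ a ⟧ → 0ℤ Int.≤ a
  ⟦⟧-nonNeg⁻¹ {+ a}      p = Int.+≤+ ℕ.z≤n
  ⟦⟧-nonNeg⁻¹ { -[1+ a ]} p = ⊥-elim (ι-suc≉0 a (O.antisym (neg-nonPos p) (0≤ι (suc a))))

  ⟦⟧-nonNeg : ∀ {a} → 0ℤ Int.≤ a → 0# ≤ ⟦ a ⟧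
  ⟦⟧-nonNeg {+ a} p = 0≤ι a

  *-cancelˡ-≈ : ∀ {a b} w → w ≉ 0# → w * a ≈ w * b → a ≈ b
  *-cancelˡ-≈ w w≉0 e = *-cancelʳ-≈ w w≉0 (R.trans (R.*-comm _ _) (R.trans e (R.*-comm _ _)))

  *-zero : ∀ {x y} → x * y ≈ 0# → x ≈ 0# ⊎ y ≈ 0#
  *-zero {x} {y} e with x O.≟ 0#
  ... | yes x≈0 = inj₁ x≈0
  ... | no  x≉0 = inj₂ (*-cancelˡ-≈ x x≉0 (R.trans e (R.sym (R.zeroʳ x))))

  x-y≈0⇒x≈y : ∀ {x y} → x - y ≈ 0# → x ≈ y
  x-y≈0⇒x≈y {x} {y} e = move e (solve 2 (λ x y → x :+ :ι 0 := y :+ (x :- y)) R.refl x y)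

  square-zero : ∀ {x} → x * x ≈ 0# → x ≈ 0#
  square-zero e = [ (λ z → z) , (λ z → z) ]′ (*-zero e)

  square-equal : ∀ {x y} → x * x ≈ y * y → x ≈ y ⊎ x ≈ - y
  square-equal {x} {y} e with *-zero {x - y} {x + y}
    (move e (solve 2 (λ x y → (x :- y) :* (x :+ y) :+ y :* y := :ι 0 :+ x :* x) R.refl x y))
  ... | inj₁ z = inj₁ (x-y≈0⇒x≈y z)
  ... | inj₂ z = inj₂ (move z (solve 2 (λ x y → x :+ :ι 0 := :- y :+ (x :+ y)) R.refl x y))

  square-injective : ∀ {x y} → 0# ≤ x → 0# ≤ y → x * x ≈ y * y → x ≈ y
  square-injective 0≤x 0≤y e =
    O.antisym (square-cancel 0≤y (O.reflexive e)) (square-cancel 0≤x (O.reflexive (R.sym e)))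

  +-zero : ∀ {x y} → 0# ≤ x → 0# ≤ y → x + y ≈ 0# → x ≈ 0# × y ≈ 0#
  +-zero {x} {y} 0≤x 0≤y e =
    O.antisym (≤-weaken e 0≤y) 0≤x ,
    O.antisym (≤-weaken (R.trans (R.+-comm y x) e) 0≤x) 0≤y

  -- `√ x` is the supremum of a predicate that mentions `x`, so it respects `≈` by uniqueness of the
  -- nonnegative root.
  √-cong : ∀ {x y} → 0# ≤ x → x ≈ y → √ x ≈ √ y
  √-cong {x} {y} 0≤x x≈y = square-injective (√-nonNegative x) (√-nonNegative y)
    (R.trans (√-square 0≤x) (R.trans x≈y (R.sym (√-square (O.≤-respʳ-≈ x≈y 0≤x)))))

  √-injective : ∀ {x y} → 0# ≤ x → 0# ≤ y → √ x ≈ √ y → x ≈ y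
  √-injective 0≤x 0≤y e =
    R.trans (R.sym (√-square 0≤x)) (R.trans (R.*-cong e e) (√-square 0≤y))

-- Sums and squared norms

δ : ∀ {d} → Fin d → Fin d → ℕ
δ i j = if does (i Finₚ.≟ j) then 1 else 0

δ-≡ : ∀ {d} {i j : Fin d} → i ≡ j → δ i j ≡ 1
δ-≡ {i = i} refl rewrite dec-true (i Finₚ.≟ i) refl = refl

δ-≢ : ∀ {d} {i j : Fin d} → i ≢ j → δ i j ≡ 0
δ-≢ {i = i} {j} i≢j rewrite dec-false (i Finₚ.≟ j) i≢j = refl

module Sums (ℛ : CompleteOrderedField) where

  open RealProperties ℛ
  open MonoidSum R.+-monoid using (sum-replicate)
  open MonoidSum R.+-monoid public using (sum-cong-≋)
  open SemiringMult R.semiring using (×-assoc-*)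

  private variable d : ℕ

  sum-snoc : (f : Vector ℝ (suc d)) → sum f ≈ sum (f ∘ inject₁) + f (fromℕ d)
  sum-snoc {zero}  f = R.+-comm _ _
  sum-snoc {suc d} f = R.trans (R.+-congˡ (sum-snoc (f ∘ suc))) (R.sym (R.+-assoc _ _ _))

  ‖_‖² : Vector ℝ d → ℝ
  ‖ f ‖² = sum (λ i → f i * f i)

  ‖‖²-cong : {f g : Vector ℝ d} → (∀ i → f i ≈ g i) → ‖ f ‖² ≈ ‖ g ‖²
  ‖‖²-cong f≈g = sum-cong-≋ (λ i → R.*-cong (f≈g i) (f≈g i))

  0≤‖‖² : (f : Vector ℝ d) → 0# ≤ ‖ f ‖²
  0≤‖‖² {zero}  f = O.refl
  0≤‖‖² {suc d} f = +-nonNeg (square-nonNeg (f zero)) (0≤‖‖² (f ∘ suc))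

  ‖‖²-zero : (f : Vector ℝ d) → ‖ f ‖² ≈ 0# → ∀ i → f i ≈ 0#
  ‖‖²-zero f e zero    = square-zero (proj₁ (+-zero (square-nonNeg (f zero)) (0≤‖‖² (f ∘ suc)) e))
  ‖‖²-zero f e (suc i) = ‖‖²-zero (f ∘ suc)
    (proj₂ (+-zero (square-nonNeg (f zero)) (0≤‖‖² (f ∘ suc)) e)) i

  sum-constant : ∀ d x → sum (λ (_ : Fin d) → x) ≈ ι d * x
  sum-constant d x = R.trans (sum-replicate d) (R.sym
    (R.trans (×-assoc-* d 1# x) (MonoidMult.×-congʳ R.+-monoid d (R.*-identityˡ _))))

  ‖‖²-constant : ∀ d x → ‖ (λ (_ : Fin d) → x) ‖² ≈ ι d * (x * x)
  ‖‖²-constant d x = sum-constant d (x * x)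

  unit : Fin d → Vector ℝ d
  unit i j = ι (δ i j)

  -- All vectors in play are a constant plus multiples of at most two unit vectors, up to the last
  -- coordinate, so their norms follow by iterating this update.
  ‖‖²-+-unit : (f : Vector ℝ d) (i : Fin d) (x : ℝ) →
    ‖ (λ j → f j + x * unit i j) ‖² ≈ ‖ f ‖² + (ι 2 * (x * f i) + x * x)
  ‖‖²-+-unit f zero x = begin
    (f zero + x * ι 1) * (f zero + x * ι 1) + ‖ (λ j → f (suc j) + x * 0#) ‖²
      ≈⟨ R.+-congˡ (‖‖²-cong (λ j → solve 2 (λ y x → y :+ x :* :ι 0 := y) R.refl (f (suc j)) x)) ⟩
    (f zero + x * ι 1) * (f zero + x * ι 1) + ‖ f ∘ suc ‖²
      ≈⟨ solve 3 (λ y x s → (y :+ x :* :ι 1) :* (y :+ x :* :ι 1) :+ s :=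
           y :* y :+ s :+ (:ι 2 :* (x :* y) :+ x :* x)) R.refl (f zero) x ‖ f ∘ suc ‖² ⟩
    f zero * f zero + ‖ f ∘ suc ‖² + (ι 2 * (x * f zero) + x * x) ∎
  ‖‖²-+-unit f (suc i) x = begin
    (f zero + x * 0#) * (f zero + x * 0#) + ‖ (λ j → f (suc j) + x * unit i j) ‖²
      ≈⟨ R.+-cong (solve 2 (λ y x → (y :+ x :* :ι 0) :* (y :+ x :* :ι 0) := y :* y) R.refl (f zero) x)
           (‖‖²-+-unit (f ∘ suc) i x) ⟩
    f zero * f zero + (‖ f ∘ suc ‖² + (ι 2 * (x * f (suc i)) + x * x))
      ≈⟨ R.sym (R.+-assoc _ _ _) ⟩
    f zero * f zero + ‖ f ∘ suc ‖² + (ι 2 * (x * f (suc i)) + x * x) ∎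

  sum-unit : ∀ {d} c x (i : Fin d) → sum (λ j → c + x * unit i j) ≈ ι d * c + x
  sum-unit {suc d} c x zero = begin
    c + x * ι 1 + sum (λ (j : Fin d) → c + x * 0#)
      ≈⟨ R.+-congˡ (sum-constant d (c + x * 0#)) ⟩
    c + x * ι 1 + ι d * (c + x * 0#)
      ≈⟨ solve 3 (λ c x d → c :+ x :* :ι 1 :+ d :* (c :+ x :* :ι 0) :=
           (:1 :+ d) :* c :+ x) R.refl c x (ι d) ⟩
    ι (suc d) * c + x ∎
  sum-unit {suc d} c x (suc i) = begin
    c + x * 0# + sum (λ j → c + x * unit i j)
      ≈⟨ R.+-congˡ (sum-unit c x i) ⟩
    c + x * 0# + (ι d * c + x)
      ≈⟨ solve 3 (λ c x d → c :+ x :* :ι 0 :+ (d :* c :+ x) := (:1 :+ d) :* c :+ x) R.refl c x (ι d) ⟩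
    ι (suc d) * c + x ∎

-- Squared distances in coordinates

module Coordinates (ℛ : CompleteOrderedField) (m : ℕ) where

  open RealProperties ℛ
  open Sums ℛ
  open Construction ℛ m

  M N : ℝ
  M = ι m
  N = ι n

  sqDist : Point → Point → ℝ
  sqDist x y = ‖ (λ i → x i - y i) ‖²

  sqDist-sym : ∀ x y → sqDist x y ≈ sqDist y x
  sqDist-sym x y = sum-cong-≋ (λ i →
    solve 2 (λ x y → (x :- y) :* (x :- y) := (y :- x) :* (y :- x)) R.refl (x i) (y i))

  sqDist-zero : ∀ x y → sqDist x y ≈ 0# → x ≋ y
  sqDist-zero x y e i = x-y≈0⇒x≈y (‖‖²-zero (λ i → x i - y i) e i)

  sqDist-≋ : ∀ x y → x ≋ y → sqDist x y ≈ 0#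
  sqDist-≋ x y x≋y = begin
    sqDist x y               ≈⟨ ‖‖²-cong (λ i → R.trans (R.+-congʳ (x≋y i)) (R.-‿inverseʳ (y i))) ⟩
    ‖ (λ (_ : Fin n) → 0#) ‖² ≈⟨ ‖‖²-constant n 0# ⟩
    ι n * (0# * 0#)          ≈⟨ solve 1 (λ x → x :* (:ι 0 :* :ι 0) := :ι 0) R.refl (ι n) ⟩
    0#                       ∎

  snoc : Vector ℝ m → ℝ → Point
  snoc v c i with view i
  ... | ‵fromℕ          = c
  ... | ‵inj₁ {i = j} _ = v j

  snoc-coordinates : ∀ v c → snoc v c ∈ HasCoordinates v c
  snoc-coordinates v c = inner , last
    where
    inner : ∀ i → snoc v c (inject₁ i) ≈ v i
    inner i rewrite view-inject₁ i = R.refl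
    last : snoc v c (fromℕ m) ≈ c
    last rewrite view-fromℕ m = R.refl

  coordinates-≋ : ∀ {v c} x y → x ∈ HasCoordinates v c → y ∈ HasCoordinates v c → x ≋ y
  coordinates-≋ x y (p , q) (p′ , q′) i with view i
  ... | ‵fromℕ          = R.trans q (R.sym q′)
  ... | ‵inj₁ {i = j} _ = R.trans (p j) (R.sym (p′ j))

  coordinates-resp : ∀ {v w c d} x y → (∀ i → v i ≈ w i) → c ≈ d → y ≋ x →
    x ∈ HasCoordinates v c → y ∈ HasCoordinates w d
  coordinates-resp x y v≈w c≈d y≋x (p , q) =
    (λ i → R.trans (y≋x _) (R.trans (p i) (v≈w i))) , R.trans (y≋x _) (R.trans q c≈d)

  sqDist-coordinates : ∀ {v w s t} x y → x ∈ HasCoordinates v s → y ∈ HasCoordinates w t →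
    sqDist x y ≈ ‖ (λ i → v i - w i) ‖² + (s - t) * (s - t)
  sqDist-coordinates x y (p , q) (p′ , q′) = R.trans
    (sum-snoc (λ i → (x i - y i) * (x i - y i))) (R.+-cong
    (‖‖²-cong (λ i → R.+-cong (p i) (R.-‿cong (p′ i))))
    (R.*-cong (R.+-cong q (R.-‿cong q′)) (R.+-cong q (R.-‿cong q′))))

  pair : Fin m → Fin m → Vector ℝ m
  pair i j l = unit i l + unit j l

  -- For fixed `x` the distance to J̃′ depends on `k` and `l` only through `v k + v l`. Squared
  -- distances 2 and 4 thus correspond to sums that differ by 1.
  sqDist-pair : ∀ {v s} k l x y → k ≢ l → x ∈ HasCoordinates v s → y ∈ HasCoordinates (pair k l) 0# →
    sqDist x y ≈ ‖ v ‖² + s * s + ι 2 - ι 2 * (v k + v l)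
  sqDist-pair {v} {s} k l x y k≢l p q = begin
    sqDist x y
      ≈⟨ sqDist-coordinates x y p q ⟩
    ‖ (λ i → v i - pair k l i) ‖² + (s - 0#) * (s - 0#)
      ≈⟨ R.+-congʳ (‖‖²-cong (λ i → solve 3 (λ v a b → v :- (a :+ b) :=
           v :+ (:- :1) :* a :+ (:- :1) :* b) R.refl (v i) (unit k i) (unit l i))) ⟩
    ‖ (λ i → v i + - 1# * unit k i + - 1# * unit l i) ‖² + (s - 0#) * (s - 0#)
      ≈⟨ R.+-congʳ (R.trans (‖‖²-+-unit _ l (- 1#)) (R.+-congʳ (‖‖²-+-unit v k (- 1#)))) ⟩
    ‖ v ‖² + (ι 2 * (- 1# * v k) + - 1# * - 1#)
      + (ι 2 * (- 1# * (v l + - 1# * unit k l)) + - 1# * - 1#) + (s - 0#) * (s - 0#)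
      -- The second update reads the first one at index `l`, where `unit k` vanishes.
      ≈⟨ R.+-congʳ (R.+-congˡ (R.+-congʳ (R.*-congˡ (R.*-congˡ (R.+-congˡ (R.*-congˡ
           (R.reflexive (≡.cong ι (δ-≢ k≢l))))))))) ⟩
    ‖ v ‖² + (ι 2 * (- 1# * v k) + - 1# * - 1#)
      + (ι 2 * (- 1# * (v l + - 1# * 0#)) + - 1# * - 1#) + (s - 0#) * (s - 0#)
      ≈⟨ solve 4 (λ q s a b →
           q :+ (:ι 2 :* ((:- :1) :* a) :+ (:- :1) :* (:- :1))
             :+ (:ι 2 :* ((:- :1) :* (b :+ (:- :1) :* :ι 0)) :+ (:- :1) :* (:- :1))
             :+ (s :- :ι 0) :* (s :- :ι 0)
           := q :+ s :* s :+ :ι 2 :- :ι 2 :* (a :+ b)) R.refl ‖ v ‖² s (v k) (v l) ⟩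
    ‖ v ‖² + s * s + ι 2 - ι 2 * (v k + v l) ∎

  ‖pair‖² : ∀ i j → i ≢ j → ‖ pair i j ‖² ≈ ι 2
  ‖pair‖² i j i≢j = begin
    ‖ pair i j ‖²
      ≈⟨ ‖‖²-cong (λ l → solve 2 (λ a b → a :+ b := :ι 0 :+ :1 :* a :+ :1 :* b) R.refl
           (unit i l) (unit j l)) ⟩
    ‖ (λ l → 0# + 1# * unit i l + 1# * unit j l) ‖²
      ≈⟨ R.trans (‖‖²-+-unit _ j 1#) (R.+-cong (R.trans (‖‖²-+-unit (λ _ → 0#) i 1#)
           (R.+-congʳ (‖‖²-constant m 0#)))
           (R.+-congʳ (R.*-congˡ (R.*-congˡ (R.+-congˡ (R.*-congˡ
             (R.reflexive (≡.cong ι (δ-≢ i≢j))))))))) ⟩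
    M * (0# * 0#) + (ι 2 * (1# * 0#) + 1# * 1#) + (ι 2 * (1# * (0# + 1# * 0#)) + 1# * 1#)
      ≈⟨ solve 1 (λ x → x :* (:ι 0 :* :ι 0) :+ (:ι 2 :* (:1 :* :ι 0) :+ :1 :* :1)
           :+ (:ι 2 :* (:1 :* (:ι 0 :+ :1 :* :ι 0)) :+ :1 :* :1) := :ι 2) R.refl M ⟩
    ι 2 ∎

  sqDist-pairs : ∀ i j k l x y → i ≢ j → k ≢ l →
    x ∈ HasCoordinates (pair i j) 0# → y ∈ HasCoordinates (pair k l) 0# →
    sqDist x y ≈ ι 4 - ι 2 * (pair i j k + pair i j l)
  sqDist-pairs i j k l x y i≢j k≢l p q = R.trans (sqDist-pair k l x y k≢l p q)
    (R.trans (R.+-congʳ (R.+-congʳ (R.+-congʳ (‖pair‖² i j i≢j))))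
      (solve 1 (λ x → :ι 2 :+ :ι 0 :* :ι 0 :+ :ι 2 :- x := :ι 4 :- x) R.refl _))

  -- The vectors of all X a have this form, with x ∈ {0, 1, -1}.
  spike : ℝ → ℝ → Fin m → Vector ℝ m
  spike c x i j = c + x * unit i j

  -- Multiplication by `n - 1` lets the sum condition eliminate `c` and `c′`: they enter only
  -- through `M * c - M * c′`, which is affine in the heights `s` and `t`.
  sqDist-spikes : ∀ {c c′ x x′ s t} i j p q →
    M * c ≈ ι 2 - x - s → M * c′ ≈ ι 2 - x′ - t →
    p ∈ HasCoordinates (spike c x i) s → q ∈ HasCoordinates (spike c′ x′ j) t →
    M * sqDist p q ≈ M * (x * x + x′ * x′ - ι 2 * (x * x′ * unit i j))
      - (x - x′) * (x - x′) + N * ((s - t) * (s - t))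
  sqDist-spikes {c} {c′} {x} {x′} {s} {t} i j p q e e′ P Q = begin
    M * sqDist p q
      ≈⟨ R.*-congˡ (R.trans (sqDist-coordinates p q P Q) (R.+-congʳ norm)) ⟩
    M * (M * ((c - c′) * (c - c′)) + (ι 2 * (x * (c - c′)) + x * x)
      + (ι 2 * (- x′ * (c - c′ + x * d)) + - x′ * - x′) + (s - t) * (s - t))
      ≈⟨ solve 8 (λ M c c′ x x′ d s t →
           M :* (M :* ((c :- c′) :* (c :- c′)) :+ (:ι 2 :* (x :* (c :- c′)) :+ x :* x)
             :+ (:ι 2 :* ((:- x′) :* (c :- c′ :+ x :* d)) :+ (:- x′) :* (:- x′)) :+ (s :- t) :* (s :- t))
           := (M :* c :- M :* c′) :* (M :* c :- M :* c′) :+ :ι 2 :* (x :- x′) :* (M :* c :- M :* c′)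
             :+ M :* (x :* x :+ x′ :* x′ :- :ι 2 :* (x :* x′ :* d) :+ (s :- t) :* (s :- t)))
           R.refl M c c′ x x′ d s t ⟩
    (M * c - M * c′) * (M * c - M * c′) + ι 2 * (x - x′) * (M * c - M * c′)
      + M * (x * x + x′ * x′ - ι 2 * (x * x′ * d) + (s - t) * (s - t))
      ≈⟨ R.+-congʳ (R.+-cong (R.*-cong h h) (R.*-congˡ h)) ⟩
    (ι 2 - x - s - (ι 2 - x′ - t)) * (ι 2 - x - s - (ι 2 - x′ - t))
      + ι 2 * (x - x′) * (ι 2 - x - s - (ι 2 - x′ - t))
      + M * (x * x + x′ * x′ - ι 2 * (x * x′ * d) + (s - t) * (s - t))
      ≈⟨ solve 6 (λ M x x′ d s t → let h = :ι 2 :- x :- s :- (:ι 2 :- x′ :- t) in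
           h :* h :+ :ι 2 :* (x :- x′) :* h
             :+ M :* (x :* x :+ x′ :* x′ :- :ι 2 :* (x :* x′ :* d) :+ (s :- t) :* (s :- t))
           := M :* (x :* x :+ x′ :* x′ :- :ι 2 :* (x :* x′ :* d)) :- (x :- x′) :* (x :- x′)
             :+ (:1 :+ M) :* ((s :- t) :* (s :- t))) R.refl M x x′ d s t ⟩
    M * (x * x + x′ * x′ - ι 2 * (x * x′ * d)) - (x - x′) * (x - x′) + N * ((s - t) * (s - t)) ∎
    where
    d = unit i j
    h : M * c - M * c′ ≈ ι 2 - x - s - (ι 2 - x′ - t)
    h = R.+-cong e (R.-‿cong e′)
    norm : ‖ (λ l → spike c x i l - spike c′ x′ j l) ‖² ≈
      M * ((c - c′) * (c - c′)) + (ι 2 * (x * (c - c′)) + x * x)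
      + (ι 2 * (- x′ * (c - c′ + x * d)) + - x′ * - x′)
    norm = R.trans (‖‖²-cong (λ l → solve 6 (λ c x a c′ x′ b →
        c :+ x :* a :- (c′ :+ x′ :* b) := c :- c′ :+ x :* a :+ (:- x′) :* b)
        R.refl c x (unit i l) c′ x′ (unit j l)))
      (R.trans (‖‖²-+-unit _ j (- x′)) (R.+-congʳ
        (R.trans (‖‖²-+-unit _ i x) (R.+-congʳ (‖‖²-constant m (c - c′))))))

  sqDist-spike-pair : ∀ {c x s} i k l p q → k ≢ l → M * c ≈ ι 2 - x - s →
    p ∈ HasCoordinates (spike c x i) s → q ∈ HasCoordinates (pair k l) 0# →
    M * sqDist p q ≈ M * (x * x + ι 2 - ι 2 * (x * (unit i k + unit i l)))
      - (ι 2 - x) * (ι 2 - x) + N * (s * s)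
  sqDist-spike-pair {c} {x} {s} i k l p q k≢l e P Q = begin
    M * sqDist p q
      ≈⟨ R.*-congˡ (R.trans (sqDist-pair k l p q k≢l P Q) (R.+-congʳ (R.+-congʳ (R.+-congʳ norm)))) ⟩
    M * (M * (c * c) + (ι 2 * (x * c) + x * x) + s * s + ι 2
      - ι 2 * (c + x * unit i k + (c + x * unit i l)))
      ≈⟨ solve 6 (λ M c x a b s →
           M :* (M :* (c :* c) :+ (:ι 2 :* (x :* c) :+ x :* x) :+ s :* s :+ :ι 2
             :- :ι 2 :* (c :+ x :* a :+ (c :+ x :* b)))
           := (M :* c) :* (M :* c) :+ :ι 2 :* (x :- :ι 2) :* (M :* c)
             :+ M :* (x :* x :+ s :* s :+ :ι 2 :- :ι 2 :* (x :* (a :+ b))))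
           R.refl M c x (unit i k) (unit i l) s ⟩
    (M * c) * (M * c) + ι 2 * (x - ι 2) * (M * c)
      + M * (x * x + s * s + ι 2 - ι 2 * (x * (unit i k + unit i l)))
      ≈⟨ R.+-congʳ (R.+-cong (R.*-cong e e) (R.*-congˡ e)) ⟩
    (ι 2 - x - s) * (ι 2 - x - s) + ι 2 * (x - ι 2) * (ι 2 - x - s)
      + M * (x * x + s * s + ι 2 - ι 2 * (x * (unit i k + unit i l)))
      ≈⟨ solve 5 (λ M x a b s → let h = :ι 2 :- x :- s in
           h :* h :+ :ι 2 :* (x :- :ι 2) :* h
             :+ M :* (x :* x :+ s :* s :+ :ι 2 :- :ι 2 :* (x :* (a :+ b)))
           := M :* (x :* x :+ :ι 2 :- :ι 2 :* (x :* (a :+ b))) :- (:ι 2 :- x) :* (:ι 2 :- x)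
             :+ (:1 :+ M) :* (s :* s)) R.refl M x (unit i k) (unit i l) s ⟩
    M * (x * x + ι 2 - ι 2 * (x * (unit i k + unit i l))) - (ι 2 - x) * (ι 2 - x) + N * (s * s) ∎
    where
    norm : ‖ spike c x i ‖² ≈ M * (c * c) + (ι 2 * (x * c) + x * x)
    norm = R.trans (‖‖²-+-unit _ i x) (R.+-congʳ (‖‖²-constant m c))

-- Permuted blocks and the common shape of the added vectors

δ-permute : ∀ {d} (π : Permutation′ d) i j → δ i (π ⟨$⟩ʳ j) ≡ δ (π ⟨$⟩ˡ i) j
δ-permute π i j with i Finₚ.≟ (π ⟨$⟩ʳ j)
... | yes i≡πj = ≡.sym (δ-≡ (≡.trans (≡.cong (π ⟨$⟩ˡ_) i≡πj) (inverseˡ π)))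
... | no  i≢πj = ≡.sym (δ-≢ λ e → i≢πj (≡.trans (≡.sym (inverseʳ π)) (≡.cong (π ⟨$⟩ʳ_) e)))

-- The block of X₄ has its exceptional entry last; this matches the Boolean test inside `block` with
-- the unit vector at `fromℕ d`.
δ-fromℕ : ∀ {d} (l : Fin (suc d)) →
  (toℕ l <ᵇ d) ≡ true × δ (fromℕ d) l ≡ 0 ⊎ (toℕ l <ᵇ d) ≡ false × δ (fromℕ d) l ≡ 1
δ-fromℕ {zero}  zero    = inj₂ (refl , refl)
δ-fromℕ {suc d} zero    = inj₁ (refl , refl)
δ-fromℕ {suc d} (suc l) = δ-fromℕ l

transposition : ∀ {d} (i j : Fin d) → ∃ λ (π : Permutation′ d) → π ⟨$⟩ˡ i ≡ j
transposition i j = transpose j i , lemma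
  where
  lemma : transpose i j ⟨$⟩ʳ i ≡ j
  lemma rewrite dec-true (i Finₚ.≟ i) refl = refl

two-points : ∀ {d} {i j : Fin (2 ℕ.+ d)} → i ≢ j →
  ∃ λ (π : Permutation′ (2 ℕ.+ d)) → π ⟨$⟩ˡ zero ≡ i × π ⟨$⟩ˡ suc zero ≡ j
two-points {i = i} i≢j =
  -- The outer `insert` sends 0 to `i`, the inner one sends the next index to the place that
  -- `punchIn i` takes to `j`; `flip` turns these images into the values of the inverse.
  flip (insert zero i (insert zero (punchOut i≢j) idₚ)) , refl , Finₚ.punchIn-punchOut i≢j

module Vectors (ℛ : CompleteOrderedField) (k : ℕ) where

  m : ℕ
  m = 4 ℕ.+ k

  open RealProperties ℛ
  open Sums ℛ
  open Coordinates ℛ m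
  open Construction ℛ m renaming (⟦_⟧ to ｛_｝)

  M≉0 : M ≉ 0#
  M≉0 = ι-suc≉0 (3 ℕ.+ k)

  N≉0 : N ≉ 0#
  N≉0 = ι-suc≉0 m

  0≤N : 0# ≤ N
  0≤N = 0≤ι n

  ⟦⟧-- : ∀ a b → ⟦ a Int.- b ⟧ ≈ ⟦ a ⟧ - ⟦ b ⟧
  ⟦⟧-- a b = R.trans (⟦⟧-+ a (Int.- b)) (R.+-congˡ (⟦⟧-neg b))

  block-unit : ∀ {u v c x} → u ≈ c + x → v ≈ c → ∀ l → block u 1 v l ≈ spike c x zero l
  block-unit {c = c} {x} u≈ v≈ zero    =
    R.trans u≈ (solve 2 (λ c x → c :+ x := c :+ x :* :ι 1) R.refl c x)
  block-unit {c = c} {x} u≈ v≈ (suc l) =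
    R.trans v≈ (solve 2 (λ c x → c := c :+ x :* :ι 0) R.refl c x)

  block-last : ∀ {u v c x} → u ≈ c → v ≈ c + x → ∀ l →
    block u (3 ℕ.+ k) v l ≈ spike c x (fromℕ (3 ℕ.+ k)) l
  block-last {u} {v} {c} {x} u≈ v≈ l with δ-fromℕ l
  ... | inj₁ (lt , δ≡) = begin
    block u (3 ℕ.+ k) v l  ≡⟨ ≡.cong (if_then u else v) lt ⟩
    u                      ≈⟨ R.trans u≈ (solve 2 (λ c x → c := c :+ x :* :ι 0) R.refl c x) ⟩
    c + x * 0#             ≡⟨ ≡.cong (λ d → c + x * ι d) (≡.sym δ≡) ⟩
    spike c x (fromℕ (3 ℕ.+ k)) l ∎
  ... | inj₂ (ge , δ≡) = begin
    block u (3 ℕ.+ k) v l  ≡⟨ ≡.cong (if_then u else v) ge ⟩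
    v                      ≈⟨ R.trans v≈ (solve 2 (λ c x → c :+ x := c :+ x :* :ι 1) R.refl c x) ⟩
    c + x * ι 1            ≡⟨ ≡.cong (λ d → c + x * ι d) (≡.sym δ≡) ⟩
    spike c x (fromℕ (3 ℕ.+ k)) l ∎

  block-pair : ∀ l → block 1# 2 0# l ≈ pair zero (suc zero) l
  block-pair zero          = solve 0 (:1 := :ι 1 :+ :ι 0) R.refl
  block-pair (suc zero)    = solve 0 (:1 := :ι 0 :+ :ι 1) R.refl
  block-pair (suc (suc l)) = solve 0 (:ι 0 := :ι 0 :+ :ι 0) R.refl

  spike-permute : ∀ c x (π : Permutation′ m) i l → spike c x i (π ⟨$⟩ʳ l) ≡ spike c x (π ⟨$⟩ˡ i) l
  spike-permute c x π i l = ≡.cong (λ d → c + x * ι d) (δ-permute π i l)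

  pair-permute : ∀ (π : Permutation′ m) i j l →
    pair i j (π ⟨$⟩ʳ l) ≡ pair (π ⟨$⟩ˡ i) (π ⟨$⟩ˡ j) l
  pair-permute π i j l = ≡.cong₂ (λ d e → ι d + ι e) (δ-permute π i l) (δ-permute π j l)

  permuted⇒spike : ∀ {v c x t} i p → (∀ l → v l ≈ spike c x i l) → p ∈ Permuted v t →
    ∃ λ j → p ∈ HasCoordinates (spike c x j) t
  permuted⇒spike {c = c} {x} i p v≈ (π , P) = (π ⟨$⟩ˡ i) ,
    coordinates-resp p p (λ l → R.trans (v≈ (π ⟨$⟩ʳ l)) (R.reflexive (spike-permute c x π i l))) R.refl
      (λ _ → R.refl) P

  spike⇒permuted : ∀ {v c x t} i p → (∀ l → v l ≈ spike c x i l) →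
    (∃ λ j → p ∈ HasCoordinates (spike c x j) t) → p ∈ Permuted v t
  spike⇒permuted {c = c} {x} i p v≈ (j , P) with transposition i j
  ... | π , refl = π ,
    coordinates-resp p p (λ l → R.sym (R.trans (v≈ (π ⟨$⟩ʳ l)) (R.reflexive (spike-permute c x π i l))))
      R.refl (λ _ → R.refl) P

  pair-comm : ∀ i j l → pair i j l ≈ pair j i l
  pair-comm i j l = R.+-comm _ _

  IsPair : Point → Set
  IsPair p = ∃ λ i → ∃ λ j → i Fin.< j × p ∈ HasCoordinates (pair i j) 0#

  J̃′⇒pair : ∀ p → p ∈ J̃′ → IsPair p
  J̃′⇒pair p (π , P) = order (Finₚ.<-cmp i j)
    where
    i = π ⟨$⟩ˡ zero
    j = π ⟨$⟩ˡ suc zero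
    Q : p ∈ HasCoordinates (pair i j) 0#
    Q = coordinates-resp p p (λ l → R.trans (block-pair (π ⟨$⟩ʳ l))
      (R.reflexive (pair-permute π zero (suc zero) l))) R.refl (λ _ → R.refl) P
    i≢j : i ≢ j
    i≢j e with ≡.trans (≡.sym (inverseʳ π {zero})) (≡.trans (≡.cong (π ⟨$⟩ʳ_) e) (inverseʳ π))
    ... | ()
    order : Tri (i Fin.< j) (i ≡ j) (j Fin.< i) → IsPair p
    order (tri< i<j _ _) = i , j , i<j , Q
    order (tri≈ _ i≡j _) = ⊥-elim (i≢j i≡j)
    order (tri> _ _ j<i) = j , i , j<i , coordinates-resp p p (pair-comm i j) R.refl (λ _ → R.refl) Q

  pair⇒J̃′ : ∀ p {i j} → i ≢ j → p ∈ HasCoordinates (pair i j) 0# → p ∈ J̃′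
  pair⇒J̃′ p i≢j P with two-points i≢j
  ... | π , refl , refl = π , coordinates-resp p p (λ l → R.sym (R.trans (block-pair (π ⟨$⟩ʳ l))
      (R.reflexive (pair-permute π zero (suc zero) l)))) R.refl (λ _ → R.refl) P

  N⁻¹ : ℝ
  N⁻¹ = N ⁻¹

  N*N⁻¹ : N * N⁻¹ ≈ 1#
  N*N⁻¹ = ⁻¹-inverseʳ N N≉0

  radius : Name → ℝ
  radius (x1 _) = ι 2 * √ N / N
  radius (x2 _) = √ (ι 2 * (N * N) + ι 2 * N) / N
  radius (x3 _) = 1#
  radius (x4 _) = √ (ι 10 * N - N * N) / N

  lastCoordinate : Name → ℝ
  lastCoordinate a = ∓[ proj₂ (family a) ] radius a

  -- Solved from the coordinate sum 2 that defines `H`. The printed closed forms are compared with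
  -- it after multiplication by `n - 1`, which clears most denominators.
  centre : Name → ℝ
  centre a = (ι 2 - ⟦ α a ⟧ - lastCoordinate a) / M

  centre-≈ : ∀ a {v} → M * v ≈ ι 2 - ⟦ α a ⟧ - lastCoordinate a → v ≈ centre a
  centre-≈ a {v} e = *-cancelˡ-≈ M M≉0 (R.trans e (begin
    y               ≈⟨ R.sym (R.*-identityʳ y) ⟩
    y * 1#          ≈⟨ R.*-congˡ (R.sym (⁻¹-inverseʳ M M≉0)) ⟩
    y * (M * M ⁻¹)  ≈⟨ solve 3 (λ y M i → y :* (M :* i) := M :* (y :* i)) R.refl y M (M ⁻¹) ⟩
    M * (y * M ⁻¹)  ∎))
    where y = ι 2 - ⟦ α a ⟧ - lastCoordinate a

  M*centre : ∀ a → M * centre a ≈ ι 2 - ⟦ α a ⟧ - lastCoordinate a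
  M*centre a = begin
    M * (y * M ⁻¹)  ≈⟨ solve 3 (λ y M i → M :* (y :* i) := y :* (M :* i)) R.refl y M (M ⁻¹) ⟩
    y * (M * M ⁻¹)  ≈⟨ R.*-congˡ (⁻¹-inverseʳ M M≉0) ⟩
    y * 1#          ≈⟨ R.*-identityʳ y ⟩
    y               ∎
    where y = ι 2 - ⟦ α a ⟧ - lastCoordinate a

  D : ℝ
  D = N * (N - 1#)

  D≉0 : D ≉ 0#
  D≉0 e = [ N≉0 , (λ z → M≉0 (R.trans (solve 1 (λ M → M := :1 :+ M :- :1) R.refl M) z)) ]′ (*-zero e)

  M*/D : ∀ x → M * (x / D) ≈ x * N⁻¹
  M*/D x = *-cancelˡ-≈ N N≉0 (begin
    N * (M * (x * D ⁻¹))
      ≈⟨ solve 3 (λ M x d → (:1 :+ M) :* (M :* (x :* d)) :=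
           x :* ((:1 :+ M) :* (:1 :+ M :- :1) :* d)) R.refl M x (D ⁻¹) ⟩
    x * (D * D ⁻¹)   ≈⟨ R.*-congˡ (R.trans (⁻¹-inverseʳ D D≉0) (R.sym N*N⁻¹)) ⟩
    x * (N * N⁻¹)    ≈⟨ solve 3 (λ x N i → x :* (N :* i) := N :* (x :* i)) R.refl x N N⁻¹ ⟩
    N * (x * N⁻¹)    ∎)

  M*/N-1 : ∀ x → M * (x / (N - 1#)) ≈ x
  M*/N-1 x = begin
    M * (x * (N - 1#) ⁻¹)
      ≈⟨ solve 3 (λ M x d → M :* (x :* d) := x :* ((:1 :+ M :- :1) :* d)) R.refl M x ((N - 1#) ⁻¹) ⟩
    x * ((N - 1#) * (N - 1#) ⁻¹)
      ≈⟨ R.*-congˡ (⁻¹-inverseʳ (N - 1#) (λ z →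
           M≉0 (R.trans (solve 1 (λ M → M := :1 :+ M :- :1) R.refl M) z))) ⟩
    x * 1#  ≈⟨ R.*-identityʳ x ⟩
    x       ∎

  ±-∓ : ∀ s y z → (±[ s ] y) * z ≈ - (∓[ s ] (y * z))
  ±-∓ ⊕ y z = R.sym (-‿involutive (y * z))
  ±-∓ ⊖ y z = R.sym (-‿distribˡ-* y z)

  ±≈-∓ : ∀ s y → ±[ s ] y ≈ - (∓[ s ] y)
  ±≈-∓ ⊕ y = R.sym (-‿involutive y)
  ±≈-∓ ⊖ y = R.refl

  -- When `α a` is 0 all indices describe one and the same vector, so the four families share a
  -- single form.
  Spike : Name → Fin m → PointSet
  Spike a i = HasCoordinates (spike (centre a) ⟦ α a ⟧ i) (lastCoordinate a)

  const⇒spike : ∀ {v c t} p → v ≈ c → p ∈ HasCoordinates (λ _ → v) t →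
    ∃ λ i → p ∈ HasCoordinates (spike c 0# i) t
  const⇒spike {v} {c} p v≈c P = zero , coordinates-resp p p
    (λ l → R.trans v≈c (solve 2 (λ c d → c := c :+ :ι 0 :* d) R.refl c (unit zero l)))
    R.refl (λ _ → R.refl) P

  spike⇒const : ∀ {v c t} p → v ≈ c → (∃ λ i → p ∈ HasCoordinates (spike c 0# i) t) →
    p ∈ HasCoordinates (λ _ → v) t
  spike⇒const {v} {c} p v≈c (i , P) = coordinates-resp p p
    (λ l → R.sym (R.trans v≈c (solve 2 (λ c d → c := c :+ :ι 0 :* d) R.refl c (unit i l))))
    R.refl (λ _ → R.refl) P

  const-centre : ∀ a y s → ⟦ α a ⟧ ≡ 0# → lastCoordinate a ≡ ∓[ s ] (y / N) →
    (ι 2 * N + ±[ s ] y) / D ≈ centre a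
  const-centre a y s α≡0 t≡ = centre-≈ a (begin
    M * ((ι 2 * N + ±[ s ] y) / D)        ≈⟨ M*/D _ ⟩
    (ι 2 * N + ±[ s ] y) * N⁻¹
      ≈⟨ solve 3 (λ N z i → (:ι 2 :* N :+ z) :* i :=
           :ι 2 :* (N :* i) :+ z :* i) R.refl N (±[ s ] y) N⁻¹ ⟩
    ι 2 * (N * N⁻¹) + ±[ s ] y * N⁻¹      ≈⟨ R.+-cong (R.*-congˡ N*N⁻¹) (±-∓ s y N⁻¹) ⟩
    ι 2 * 1# - ∓[ s ] (y / N)
      ≈⟨ solve 1 (λ z → :ι 2 :* :1 :- z := :ι 2 :- :ι 0 :- z) R.refl (∓[ s ] (y / N)) ⟩
    ι 2 - 0# - ∓[ s ] (y / N)             ≡⟨ ≡.sym (≡.cong₂ (λ x z → ι 2 - x - z) α≡0 t≡) ⟩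
    ι 2 - ⟦ α a ⟧ - lastCoordinate a      ∎)

  centre-x3 : ∀ s → (1# + ±[ s ] 1#) / (N - 1#) ≈ centre (x3 s)
  centre-x3 s = centre-≈ (x3 s) (begin
    M * ((1# + ±[ s ] 1#) / (N - 1#))  ≈⟨ M*/N-1 _ ⟩
    1# + ±[ s ] 1#                     ≈⟨ R.+-congˡ (±≈-∓ s 1#) ⟩
    1# - ∓[ s ] 1#
      ≈⟨ solve 1 (λ z → :1 :- z := :ι 2 :- :ι 1 :- z) R.refl (∓[ s ] 1#) ⟩
    ι 2 - ι 1 - ∓[ s ] 1#              ∎)

  peak-x3 : ∀ s → (N + ±[ s ] 1#) / (N - 1#) ≈ centre (x3 s) + ⟦ 1ℤ ⟧
  peak-x3 s = *-cancelˡ-≈ M M≉0 (begin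
    M * ((N + ±[ s ] 1#) / (N - 1#))       ≈⟨ M*/N-1 _ ⟩
    N + ±[ s ] 1#                          ≈⟨ R.+-congˡ (±≈-∓ s 1#) ⟩
    N - ∓[ s ] 1#
      ≈⟨ solve 2 (λ M z → :1 :+ M :- z := :ι 2 :- :ι 1 :- z :+ M :* :ι 1) R.refl M (∓[ s ] 1#) ⟩
    ι 2 - ι 1 - ∓[ s ] 1# + M * ι 1        ≈⟨ R.+-congʳ (R.sym (M*centre (x3 s))) ⟩
    M * centre (x3 s) + M * ι 1            ≈⟨ R.sym (R.distribˡ _ _ _) ⟩
    M * (centre (x3 s) + ι 1)              ∎)

  q₄ : ℝ
  q₄ = ι 10 * N - N * N

  centre-x4 : ∀ s → (ι 3 * N + ±[ s ] √ q₄) / D ≈ centre (x4 s)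
  centre-x4 s = centre-≈ (x4 s) (begin
    M * ((ι 3 * N + ±[ s ] √ q₄) / D)        ≈⟨ M*/D _ ⟩
    (ι 3 * N + ±[ s ] √ q₄) * N⁻¹
      ≈⟨ solve 3 (λ N z i → (:ι 3 :* N :+ z) :* i :=
           :ι 3 :* (N :* i) :+ z :* i) R.refl N (±[ s ] √ q₄) N⁻¹ ⟩
    ι 3 * (N * N⁻¹) + ±[ s ] √ q₄ * N⁻¹      ≈⟨ R.+-cong (R.*-congˡ N*N⁻¹) (±-∓ s (√ q₄) N⁻¹) ⟩
    ι 3 * 1# - ∓[ s ] (√ q₄ / N)
      ≈⟨ solve 1 (λ z → :ι 3 :* :1 :- z := :ι 2 :- con -1ℤ :- z) R.refl (∓[ s ] (√ q₄ / N)) ⟩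
    ι 2 - ⟦ -1ℤ ⟧ - ∓[ s ] (√ q₄ / N)        ∎)

  peak-x4 : ∀ s → (- (N * N) + ι 4 * N + ±[ s ] √ q₄) / D ≈ centre (x4 s) + ⟦ -1ℤ ⟧
  peak-x4 s = *-cancelˡ-≈ M M≉0 (begin
    M * ((- (N * N) + ι 4 * N + ±[ s ] √ q₄) / D)   ≈⟨ M*/D _ ⟩
    (- (N * N) + ι 4 * N + ±[ s ] √ q₄) * N⁻¹
      ≈⟨ solve 3 (λ N z i → (:- (N :* N) :+ :ι 4 :* N :+ z) :* i :=
           (:ι 4 :- N) :* (N :* i) :+ z :* i) R.refl N (±[ s ] √ q₄) N⁻¹ ⟩
    (ι 4 - N) * (N * N⁻¹) + ±[ s ] √ q₄ * N⁻¹
      ≈⟨ R.+-cong (R.*-congˡ N*N⁻¹) (±-∓ s (√ q₄) N⁻¹) ⟩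
    (ι 4 - N) * 1# - ∓[ s ] (√ q₄ / N)
      ≈⟨ solve 2 (λ M z → (:ι 4 :- (:1 :+ M)) :* :1 :- z := :ι 2 :- con -1ℤ :- z :+ M :* con -1ℤ)
           R.refl M (∓[ s ] (√ q₄ / N)) ⟩
    ι 2 - ⟦ -1ℤ ⟧ - ∓[ s ] (√ q₄ / N) + M * ⟦ -1ℤ ⟧ ≈⟨ R.+-congʳ (R.sym (M*centre (x4 s))) ⟩
    M * centre (x4 s) + M * ⟦ -1ℤ ⟧                 ≈⟨ R.sym (R.distribˡ _ _ _) ⟩
    M * (centre (x4 s) + ⟦ -1ℤ ⟧)                   ∎)

  X⇒spike : ∀ a p → p ∈ X a → ∃ λ i → p ∈ Spike a i
  X⇒spike (x1 s) p = const⇒spike p (const-centre (x1 s) (ι 2 * √ N) s refl refl)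
  X⇒spike (x2 s) p = const⇒spike p (const-centre (x2 s) (√ (ι 2 * (N * N) + ι 2 * N)) s refl refl)
  -- The exceptional entry opens the block of X₃ and closes that of X₄.
  X⇒spike (x3 s) p = permuted⇒spike zero p (block-unit (peak-x3 s) (centre-x3 s))
  X⇒spike (x4 s) p = permuted⇒spike (fromℕ (3 ℕ.+ k)) p (block-last (centre-x4 s) (peak-x4 s))

  spike⇒X : ∀ a p → (∃ λ i → p ∈ Spike a i) → p ∈ X a
  spike⇒X (x1 s) p = spike⇒const p (const-centre (x1 s) (ι 2 * √ N) s refl refl)
  spike⇒X (x2 s) p = spike⇒const p (const-centre (x2 s) (√ (ι 2 * (N * N) + ι 2 * N)) s refl refl)
  spike⇒X (x3 s) p = spike⇒permuted zero p (block-unit (peak-x3 s) (centre-x3 s))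
  spike⇒X (x4 s) p = spike⇒permuted (fromℕ (3 ℕ.+ k)) p (block-last (centre-x4 s) (peak-x4 s))

-- From real squared distances to the integer criterion

direction-square : ∀ a → direction a Int.* direction a ≡ 1ℤ
direction-square a with proj₂ (family a)
... | ⊕ = refl
... | ⊖ = refl

module SquaredDistances (ℛ : CompleteOrderedField) (k : ℕ) where

  open RealProperties ℛ
  open Sums ℛ
  open Vectors ℛ k
  open Coordinates ℛ m
  open Construction ℛ m renaming (⟦_⟧ to ｛_｝)

  N*quotient² : ∀ y → N * (y / N * (y / N)) ≈ y * y * N⁻¹
  N*quotient² y = begin
    N * (y * N⁻¹ * (y * N⁻¹))
      ≈⟨ solve 3 (λ N y i → N :* (y :* i :* (y :* i)) := y :* y :* i :* (N :* i)) R.refl N y N⁻¹ ⟩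
    y * y * N⁻¹ * (N * N⁻¹)   ≈⟨ R.*-congˡ N*N⁻¹ ⟩
    y * y * N⁻¹ * 1#          ≈⟨ R.*-identityʳ _ ⟩
    y * y * N⁻¹               ∎

  N-cancel : ∀ x → x * N * N⁻¹ ≈ x
  N-cancel x = R.trans (R.*-assoc x N N⁻¹) (R.trans (R.*-congˡ N*N⁻¹) (R.*-identityʳ x))

  ∓-square : ∀ s y → ∓[ s ] y * ∓[ s ] y ≈ y * y
  ∓-square ⊕ y = solve 1 (λ y → (:- y) :* (:- y) := y :* y) R.refl y
  ∓-square ⊖ y = R.refl

  ι-mono : ∀ {a b} → a ℕ.≤ b → 0# ≤ ι b - ι a
  ι-mono {a} {b} a≤b = O.≤-respʳ-≈ (⟦⟧-- (+ b) (+ a)) (⟦⟧-nonNeg (ℤₚ.i≤j⇒0≤j-i (Int.+≤+ a≤b)))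

  ⟦height²⟧ : ∀ a → ⟦ height² m a ⟧ ≈ (ι 2 - ⟦ α a ⟧) * (ι 2 - ⟦ α a ⟧) + ⟦ slope a ⟧ * M
  ⟦height²⟧ a = begin
    ⟦ (+ 2 Int.- α a) Int.* (+ 2 Int.- α a) Int.+ slope a Int.* + m ⟧
      ≈⟨ ⟦⟧-+ ((+ 2 Int.- α a) Int.* (+ 2 Int.- α a)) (slope a Int.* + m) ⟩
    ⟦ (+ 2 Int.- α a) Int.* (+ 2 Int.- α a) ⟧ + ⟦ slope a Int.* + m ⟧
      ≈⟨ R.+-cong (⟦⟧-* (+ 2 Int.- α a) (+ 2 Int.- α a)) (⟦⟧-* (slope a) (+ m)) ⟩
    ⟦ + 2 Int.- α a ⟧ * ⟦ + 2 Int.- α a ⟧ + ⟦ slope a ⟧ * M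
      ≈⟨ R.+-congʳ (R.*-cong (⟦⟧-- (+ 2) (α a)) (⟦⟧-- (+ 2) (α a))) ⟩
    (ι 2 - ⟦ α a ⟧) * (ι 2 - ⟦ α a ⟧) + ⟦ slope a ⟧ * M ∎

  N*radius² : ∀ a → Present n a → N * (radius a * radius a) ≈
    (ι 2 - ⟦ α a ⟧) * (ι 2 - ⟦ α a ⟧) + ⟦ slope a ⟧ * M
  N*radius² (x1 s) _ = begin
    N * (ι 2 * √ N / N * (ι 2 * √ N / N))   ≈⟨ N*quotient² _ ⟩
    ι 2 * √ N * (ι 2 * √ N) * N⁻¹
      ≈⟨ solve 2 (λ r i → :ι 2 :* r :* (:ι 2 :* r) :* i := :ι 4 :* (r :* r) :* i) R.refl (√ N) N⁻¹ ⟩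
    ι 4 * (√ N * √ N) * N⁻¹                 ≈⟨ R.*-congʳ (R.*-congˡ (√-square 0≤N)) ⟩
    ι 4 * N * N⁻¹                           ≈⟨ N-cancel (ι 4) ⟩
    ι 4
      ≈⟨ solve 1 (λ M → :ι 4 := (:ι 2 :- :ι 0) :* (:ι 2 :- :ι 0) :+ :ι 0 :* M) R.refl M ⟩
    (ι 2 - 0#) * (ι 2 - 0#) + 0# * M        ∎
  N*radius² (x2 s) _ = begin
    N * (√ q / N * (√ q / N))   ≈⟨ N*quotient² _ ⟩
    √ q * √ q * N⁻¹             ≈⟨ R.*-congʳ (√-square 0≤q) ⟩
    q * N⁻¹
      ≈⟨ solve 2 (λ N i → (:ι 2 :* (N :* N) :+ :ι 2 :* N) :* i :=
           (:ι 2 :* N :+ :ι 2) :* N :* i) R.refl N N⁻¹ ⟩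
    (ι 2 * N + ι 2) * N * N⁻¹   ≈⟨ N-cancel _ ⟩
    ι 2 * N + ι 2
      ≈⟨ solve 1 (λ M → :ι 2 :* (:1 :+ M) :+ :ι 2 :=
           (:ι 2 :- :ι 0) :* (:ι 2 :- :ι 0) :+ :ι 2 :* M) R.refl M ⟩
    (ι 2 - 0#) * (ι 2 - 0#) + ι 2 * M ∎
    where
    q = ι 2 * (N * N) + ι 2 * N
    0≤q : 0# ≤ q
    0≤q = +-nonNeg (*-nonNegative (0≤ι 2) (*-nonNegative 0≤N 0≤N)) (*-nonNegative (0≤ι 2) 0≤N)
  N*radius² (x3 s) _ = solve 1 (λ M → (:1 :+ M) :* (:1 :* :1) :=
    (:ι 2 :- :ι 1) :* (:ι 2 :- :ι 1) :+ :ι 1 :* M) R.refl M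
  N*radius² (x4 s) n≤10 = begin
    N * (√ q₄ / N * (√ q₄ / N))   ≈⟨ N*quotient² _ ⟩
    √ q₄ * √ q₄ * N⁻¹             ≈⟨ R.*-congʳ (√-square 0≤q) ⟩
    q₄ * N⁻¹                      ≈⟨ R.*-congʳ q≈ ⟩
    (ι 10 - N) * N * N⁻¹          ≈⟨ N-cancel _ ⟩
    ι 10 - N
      ≈⟨ solve 1 (λ M → :ι 10 :- (:1 :+ M) :=
           (:ι 2 :- con -1ℤ) :* (:ι 2 :- con -1ℤ) :+ con -1ℤ :* M) R.refl M ⟩
    (ι 2 - ⟦ -1ℤ ⟧) * (ι 2 - ⟦ -1ℤ ⟧) + ⟦ -1ℤ ⟧ * M ∎
    where
    q≈ : q₄ ≈ (ι 10 - N) * N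
    q≈ = solve 2 (λ t N → t :* N :- N :* N := (t :- N) :* N) R.refl (ι 10) N
    -- Presence of X₄ means `n ≤ 10`, which makes `(10 - n) n` nonnegative.
    0≤q : 0# ≤ q₄
    0≤q = O.≤-respʳ-≈ (R.sym q≈) (*-nonNegative (ι-mono n≤10) 0≤N)

  N*last² : ∀ a → Present n a → N * (lastCoordinate a * lastCoordinate a) ≈ ⟦ height² m a ⟧
  N*last² a pa = R.trans (R.*-congˡ (∓-square (proj₂ (family a)) (radius a)))
    (R.trans (N*radius² a pa) (R.sym (⟦height²⟧ a)))

  0≤N⁻¹ : 0# ≤ N⁻¹
  0≤N⁻¹ = *-cancelʳ-≤ N N≉0 0≤N (O.≤-respˡ-≈ (R.sym (R.zeroˡ N))
    (O.≤-respʳ-≈ (R.trans (R.sym N*N⁻¹) (R.*-comm N N⁻¹)) 0≤1))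

  0≤radius : ∀ a → 0# ≤ radius a
  0≤radius (x1 s) = *-nonNegative (*-nonNegative (0≤ι 2) (√-nonNegative N)) 0≤N⁻¹
  0≤radius (x2 s) = *-nonNegative (√-nonNegative _) 0≤N⁻¹
  0≤radius (x3 s) = 0≤1
  0≤radius (x4 s) = *-nonNegative (√-nonNegative _) 0≤N⁻¹

  last-direction : ∀ a → lastCoordinate a ≈ - (⟦ direction a ⟧ * radius a)
  last-direction a with proj₂ (family a)
  ... | ⊕ = solve 1 (λ r → :- r := :- (:ι 1 :* r)) R.refl (radius a)
  ... | ⊖ = solve 1 (λ r → r := :- (con -1ℤ :* r)) R.refl (radius a)

  ⟦direction⟧² : ∀ a → ⟦ direction a ⟧ * ⟦ direction a ⟧ ≈ 1#
  ⟦direction⟧² a = begin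
    ⟦ direction a ⟧ * ⟦ direction a ⟧  ≈⟨ R.sym (⟦⟧-* (direction a) (direction a)) ⟩
    ⟦ direction a Int.* direction a ⟧  ≡⟨ ≡.cong ⟦_⟧ (direction-square a) ⟩
    ι 1                                ≈⟨ R.+-identityʳ 1# ⟩
    1#                                 ∎

  module _ (a b : Name) (pa : Present n a) (pb : Present n b) where

    σ : ℤ
    σ = direction a Int.* direction b

    -- Twice N times the product of the last coordinates: the only irrational
    -- term in the squared distance.
    cross : ℝ
    cross = ι 2 * (N * (lastCoordinate a * lastCoordinate b))

    ⟦σ⟧² : ⟦ σ ⟧ * ⟦ σ ⟧ ≈ 1#
    ⟦σ⟧² = begin
      ⟦ σ ⟧ * ⟦ σ ⟧   ≈⟨ R.*-cong h h ⟩
      x * y * (x * y) ≈⟨ solve 2 (λ x y → x :* y :* (x :* y) := x :* x :* (y :* y)) R.refl x y ⟩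
      x * x * (y * y) ≈⟨ R.*-cong (⟦direction⟧² a) (⟦direction⟧² b) ⟩
      1# * 1#         ≈⟨ R.*-identityˡ 1# ⟩
      1#              ∎
      where
      x = ⟦ direction a ⟧
      y = ⟦ direction b ⟧
      h = ⟦⟧-* (direction a) (direction b)

    cross-square : cross * cross ≈ ⟦ + 4 Int.* (height² m a Int.* height² m b) ⟧
    cross-square = begin
      cross * cross
        ≈⟨ solve 3 (λ N s t → :ι 2 :* (N :* (s :* t)) :* (:ι 2 :* (N :* (s :* t))) :=
             :ι 4 :* (N :* (s :* s) :* (N :* (t :* t)))) R.refl N (lastCoordinate a) (lastCoordinate b) ⟩
      ι 4 * (N * (lastCoordinate a * lastCoordinate a) * (N * (lastCoordinate b * lastCoordinate b)))
        ≈⟨ R.*-congˡ (R.trans (R.*-cong (N*last² a pa) (N*last² b pb))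
             (R.sym (⟦⟧-* (height² m a) (height² m b)))) ⟩
      ι 4 * ⟦ height² m a Int.* height² m b ⟧
        ≈⟨ R.sym (⟦⟧-* (+ 4) (height² m a Int.* height² m b)) ⟩
      ⟦ + 4 Int.* (height² m a Int.* height² m b) ⟧ ∎

    -- Each last coordinate is minus its direction times a nonnegative radius, and each direction
    -- squares to 1.
    cross-sign : 0# ≤ ⟦ σ ⟧ * cross
    cross-sign = O.≤-respʳ-≈ (R.sym (begin
      ⟦ σ ⟧ * cross
        ≈⟨ R.*-congˡ (R.*-congˡ (R.*-congˡ (R.*-cong (last-direction a) (last-direction b)))) ⟩
      ⟦ σ ⟧ * (ι 2 * (N * (- (x * r) * - (y * r′))))
        ≈⟨ R.*-congʳ (⟦⟧-* (direction a) (direction b)) ⟩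
      x * y * (ι 2 * (N * (- (x * r) * - (y * r′))))
        ≈⟨ solve 5 (λ N x y r r′ → x :* y :* (:ι 2 :* (N :* ((:- (x :* r)) :* (:- (y :* r′))))) :=
             x :* x :* (y :* y) :* (:ι 2 :* (N :* (r :* r′)))) R.refl N x y r r′ ⟩
      x * x * (y * y) * (ι 2 * (N * (r * r′)))
        ≈⟨ R.*-congʳ (R.*-cong (⟦direction⟧² a) (⟦direction⟧² b)) ⟩
      1# * 1# * (ι 2 * (N * (r * r′)))
        ≈⟨ R.trans (R.*-congʳ (R.*-identityˡ 1#)) (R.*-identityˡ _) ⟩
      ι 2 * (N * (r * r′)) ∎))
      (*-nonNegative (0≤ι 2) (*-nonNegative 0≤N (*-nonNegative (0≤radius a) (0≤radius b))))
      where
      x = ⟦ direction a ⟧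
      y = ⟦ direction b ⟧
      r = radius a
      r′ = radius b

    cross-excess⇒ : ∀ δ w → cross ≈ ⟦ excess m a b δ w ⟧ → AtDistance m a b δ w
    cross-excess⇒ δ w e =
      ⟦⟧-cancel (R.trans (R.sym cross-square) (R.trans (R.*-cong e e) (R.sym (⟦⟧-* E E)))) ,
      ⟦⟧-nonNeg⁻¹ (O.≤-respʳ-≈ (R.trans (R.*-congˡ e) (R.sym (⟦⟧-* σ E))) cross-sign)
      where E = excess m a b δ w

    -- A real number is determined by its square and its sign: after multiplication by `σ` both
    -- sides are nonnegative with equal squares, and a second multiplication by `σ` undoes the
    -- first.
    cross-excess⇐ : ∀ δ w → AtDistance m a b δ w → cross ≈ ⟦ excess m a b δ w ⟧
    cross-excess⇐ δ w (eq , sgn) = begin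
      cross                     ≈⟨ R.sym (unsign cross) ⟩
      ⟦ σ ⟧ * (⟦ σ ⟧ * cross)   ≈⟨ R.*-congˡ (square-injective cross-sign
        (O.≤-respʳ-≈ (⟦⟧-* σ E) (⟦⟧-nonNeg sgn)) (begin
          ⟦ σ ⟧ * cross * (⟦ σ ⟧ * cross)   ≈⟨ square (⟦ σ ⟧) cross ⟩
          ⟦ σ ⟧ * ⟦ σ ⟧ * (cross * cross)
            ≈⟨ R.*-congˡ (R.trans cross-square (R.trans (R.reflexive (≡.cong ⟦_⟧ eq)) (⟦⟧-* E E))) ⟩
          ⟦ σ ⟧ * ⟦ σ ⟧ * (⟦ E ⟧ * ⟦ E ⟧)   ≈⟨ R.sym (square (⟦ σ ⟧) (⟦ E ⟧)) ⟩
          ⟦ σ ⟧ * ⟦ E ⟧ * (⟦ σ ⟧ * ⟦ E ⟧)   ∎)) ⟩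
      ⟦ σ ⟧ * (⟦ σ ⟧ * ⟦ E ⟧)   ≈⟨ unsign (⟦ E ⟧) ⟩
      ⟦ E ⟧                     ∎
      where
      E = excess m a b δ w
      square : ∀ x y → x * y * (x * y) ≈ x * x * (y * y)
      square = solve 2 (λ x y → x :* y :* (x :* y) := x :* x :* (y :* y)) R.refl
      unsign : ∀ x → ⟦ σ ⟧ * (⟦ σ ⟧ * x) ≈ x
      unsign x = R.trans (R.sym (R.*-assoc _ _ _)) (R.trans (R.*-congʳ ⟦σ⟧²) (R.*-identityˡ x))

    ⟦excess⟧ : ∀ δ w → ⟦ excess m a b δ w ⟧ ≈
      M * (⟦ α a ⟧ * ⟦ α a ⟧ + ⟦ α b ⟧ * ⟦ α b ⟧ - ι 2 * (⟦ α a ⟧ * ⟦ α b ⟧ * ι δ) - ι w)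
        - (⟦ α a ⟧ - ⟦ α b ⟧) * (⟦ α a ⟧ - ⟦ α b ⟧) + ⟦ height² m a ⟧ + ⟦ height² m b ⟧
    ⟦excess⟧ δ w = begin
      ⟦ M′ Int.- S Int.+ height² m a Int.+ height² m b ⟧
        ≈⟨ R.trans (⟦⟧-+ (M′ Int.- S Int.+ height² m a) (height² m b))
             (R.+-congʳ (R.trans (⟦⟧-+ (M′ Int.- S) (height² m a)) (R.+-congʳ (⟦⟧-- M′ S)))) ⟩
      ⟦ M′ ⟧ - ⟦ S ⟧ + ⟦ height² m a ⟧ + ⟦ height² m b ⟧
        ≈⟨ R.+-congʳ (R.+-congʳ (R.+-cong
             (R.trans (⟦⟧-* (+ m) Q) (R.*-congˡ ⟦Q⟧))
             (R.-‿cong (R.trans (⟦⟧-* (x Int.- y) (x Int.- y)) (R.*-cong (⟦⟧-- x y) (⟦⟧-- x y)))))) ⟩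
      M * (⟦ x ⟧ * ⟦ x ⟧ + ⟦ y ⟧ * ⟦ y ⟧ - ι 2 * (⟦ x ⟧ * ⟦ y ⟧ * ι δ) - ι w)
        - (⟦ x ⟧ - ⟦ y ⟧) * (⟦ x ⟧ - ⟦ y ⟧) + ⟦ height² m a ⟧ + ⟦ height² m b ⟧ ∎
      where
      x = α a
      y = α b
      Q = x Int.* x Int.+ y Int.* y Int.- + 2 Int.* (x Int.* y Int.* + δ) Int.- + w
      M′ = + m Int.* Q
      S = (x Int.- y) Int.* (x Int.- y)
      ⟦Q⟧ : ⟦ Q ⟧ ≈ ⟦ x ⟧ * ⟦ x ⟧ + ⟦ y ⟧ * ⟦ y ⟧ - ι 2 * (⟦ x ⟧ * ⟦ y ⟧ * ι δ) - ι w
      ⟦Q⟧ = R.trans (⟦⟧-- (x Int.* x Int.+ y Int.* y Int.- + 2 Int.* (x Int.* y Int.* + δ)) (+ w))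
        (R.+-congʳ (R.trans (⟦⟧-- (x Int.* x Int.+ y Int.* y) (+ 2 Int.* (x Int.* y Int.* + δ)))
          (R.+-cong (R.trans (⟦⟧-+ (x Int.* x) (y Int.* y)) (R.+-cong (⟦⟧-* x x) (⟦⟧-* y y)))
            (R.-‿cong (R.trans (⟦⟧-* (+ 2) (x Int.* y Int.* + δ)) (R.*-congˡ
              (R.trans (⟦⟧-* (x Int.* y) (+ δ)) (R.*-congʳ (⟦⟧-* x y)))))))))

    -- Expanding `N (s - t)²`, the squares are the integer heights, and adding `cross` removes the
    -- mixed term.
    M*sqDist : ∀ i j w p q → p ∈ Spike a i → q ∈ Spike b j →
      M * sqDist p q + cross ≈ M * ι w + ⟦ excess m a b (δ i j) w ⟧
    M*sqDist i j w p q P Q = begin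
      M * sqDist p q + cross
        ≈⟨ R.+-congʳ (sqDist-spikes i j p q (M*centre a) (M*centre b) P Q) ⟩
      M * (x * x + y * y - ι 2 * (x * y * d)) - (x - y) * (x - y) + N * ((s - t) * (s - t)) + cross
        ≈⟨ solve 7 (λ M x y d s t w → let N = :1 :+ M in
             M :* (x :* x :+ y :* y :- :ι 2 :* (x :* y :* d)) :- (x :- y) :* (x :- y)
               :+ N :* ((s :- t) :* (s :- t)) :+ :ι 2 :* (N :* (s :* t))
             := M :* w :+ (M :* (x :* x :+ y :* y :- :ι 2 :* (x :* y :* d) :- w)
               :- (x :- y) :* (x :- y) :+ N :* (s :* s) :+ N :* (t :* t))) R.refl M x y d s t (ι w) ⟩
      M * ι w + (M * (x * x + y * y - ι 2 * (x * y * d) - ι w) - (x - y) * (x - y)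
        + N * (s * s) + N * (t * t))
        ≈⟨ R.+-congˡ (R.trans (R.+-cong (R.+-congˡ (N*last² a pa)) (N*last² b pb))
             (R.sym (⟦excess⟧ (δ i j) w))) ⟩
      M * ι w + ⟦ excess m a b (δ i j) w ⟧ ∎
      where
      x = ⟦ α a ⟧
      y = ⟦ α b ⟧
      d = ι (δ i j)
      s = lastCoordinate a
      t = lastCoordinate b

    sqDist⇒ : ∀ i j w p q → p ∈ Spike a i → q ∈ Spike b j →
      sqDist p q ≈ ι w → AtDistance m a b (δ i j) w
    sqDist⇒ i j w p q P Q e = cross-excess⇒ (δ i j) w
      (move (R.trans (R.+-congʳ (R.*-congˡ (R.sym e))) (M*sqDist i j w p q P Q))
        (solve 3 (λ c d e → c :+ (d :+ e) := e :+ (d :+ c)) R.refl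
          cross (M * ι w) (⟦ excess m a b (δ i j) w ⟧)))

    sqDist⇐ : ∀ i j w p q → p ∈ Spike a i → q ∈ Spike b j →
      AtDistance m a b (δ i j) w → sqDist p q ≈ ι w
    sqDist⇐ i j w p q P Q r = *-cancelˡ-≈ M M≉0
      (move (M*sqDist i j w p q P Q)
        (R.trans (R.+-congˡ (R.+-congˡ (R.sym (cross-excess⇐ (δ i j) w r))))
          (solve 3 (λ d w c → d :+ (w :+ c) := w :+ (d :+ c)) R.refl (M * sqDist p q) (M * ι w) cross)))

-- The distances √2 and √4

δ-cases : ∀ {d} (i j : Fin d) → δ i j ≡ 0 ⊎ δ i j ≡ 1
δ-cases i j with i Finₚ.≟ j
... | yes _ = inj₂ refl
... | no  _ = inj₁ refl

δ+δ-cases : ∀ {d} (i : Fin d) {k l} → k ≢ l → δ i k ℕ.+ δ i l ≡ 0 ⊎ δ i k ℕ.+ δ i l ≡ 1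
δ+δ-cases i {k} {l} k≢l with i Finₚ.≟ k | i Finₚ.≟ l
... | yes i≡k | yes i≡l = ⊥-elim (k≢l (≡.trans (≡.sym i≡k) i≡l))
... | yes _   | no  _   = inj₂ refl
... | no  _   | yes _   = inj₂ refl
... | no  _   | no  _   = inj₁ refl

-- The number of common elements of {i , j} and {k , l}.
meet : ∀ {d} (i j k l : Fin d) → ℕ
meet i j k l = (δ i k ℕ.+ δ j k) ℕ.+ (δ i l ℕ.+ δ j l)

meet-cases : ∀ {d} {i j k l : Fin d} → i Fin.< j → k Fin.< l →
  (i ≡ k × j ≡ l) ⊎ meet i j k l ≡ 0 ⊎ meet i j k l ≡ 1
meet-cases {i = i} {j} {k} {l} i<j k<l
  with i Finₚ.≟ k | j Finₚ.≟ k | i Finₚ.≟ l | j Finₚ.≟ l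
... | yes i≡k  | _        | _        | yes j≡l  = inj₁ (i≡k , j≡l)
... | yes i≡k  | yes j≡k  | _        | _        = ⊥-elim (Finₚ.<⇒≢ i<j (≡.trans i≡k (≡.sym j≡k)))
... | yes i≡k  | _        | yes i≡l  | _        = ⊥-elim (Finₚ.<⇒≢ k<l (≡.trans (≡.sym i≡k) i≡l))
... | yes _    | no _     | no _     | no _     = inj₂ (inj₂ refl)
... | no _     | yes refl | yes refl | _        = ⊥-elim (Finₚ.<-asym i<j k<l)
... | no _     | yes j≡k  | _        | yes j≡l  = ⊥-elim (Finₚ.<⇒≢ k<l (≡.trans (≡.sym j≡k) j≡l))
... | no _     | yes _    | no _     | no _     = inj₂ (inj₂ refl)
... | no _     | no _     | yes i≡l  | yes j≡l  = ⊥-elim (Finₚ.<⇒≢ i<j (≡.trans i≡l (≡.sym j≡l)))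
... | no _     | no _     | yes _    | no _     = inj₂ (inj₂ refl)
... | no _     | no _     | no _     | yes _    = inj₂ (inj₂ refl)
... | no _     | no _     | no _     | no _     = inj₂ (inj₁ refl)

module TwoDistanceSets (ℛ : CompleteOrderedField) (k : ℕ) where

  open RealProperties ℛ
  open Sums ℛ
  open Vectors ℛ k
  open Coordinates ℛ m
  open SquaredDistances ℛ k
  open Construction ℛ m renaming (⟦_⟧ to ｛_｝)

  TwoFour : Point → Point → Set
  TwoFour p q = sqDist p q ≈ ι 2 ⊎ sqDist p q ≈ ι 4

  Near : Point → Point → Set
  Near p q = p ≋ q ⊎ TwoFour p q

  ≋-sym : ∀ {p q : Point} → p ≋ q → q ≋ p
  ≋-sym p≋q i = R.sym (p≋q i)

  near-sym : ∀ p q → Near p q → Near q p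
  near-sym p q (inj₁ p≋q) = inj₁ (λ i → R.sym (p≋q i))
  near-sym p q (inj₂ d)   = inj₂ (Sum.map (R.trans (sqDist-sym q p)) (R.trans (sqDist-sym q p)) d)

  twoFour⇒≉ : ∀ p q → TwoFour p q → ¬ (p ≋ q)
  twoFour⇒≉ p q d p≋q =
    [ (λ e → ι-suc≉0 1 (R.trans (R.sym e) (sqDist-≋ p q p≋q)))
    , (λ e → ι-suc≉0 3 (R.trans (R.sym e) (sqDist-≋ p q p≋q))) ]′ d

  -- Inserting the value of `n t²` cancels `(2 - α)²`; division by `n - 1` leaves
  -- `α² + 2 - 2 α d + slope`, where `d` tells whether the exceptional coordinate lies in `{k, l}`.
  -- The slopes are such that this is 2 or 4.
  spike-pair : ∀ a i k l p q → Present n a → k ≢ l → p ∈ Spike a i → q ∈ HasCoordinates (pair k l) 0# →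
    TwoFour p q
  spike-pair a i k l p q pa k≢l P Q = cases a (δ+δ-cases i k≢l)
    (*-cancelˡ-≈ M M≉0 (begin
      M * sqDist p q
        ≈⟨ sqDist-spike-pair i k l p q k≢l (M*centre a) P Q ⟩
      M * (x * x + ι 2 - ι 2 * (x * (unit i k + unit i l))) - (ι 2 - x) * (ι 2 - x) + N * (t * t)
        ≈⟨ R.+-cong (R.+-congʳ (R.*-congˡ (R.+-congˡ (R.-‿cong (R.*-congˡ (R.*-congˡ
             (R.sym (ι-+ (δ i k) (δ i l)))))))))
             (R.trans (N*last² a pa) (⟦height²⟧ a)) ⟩
      M * (x * x + ι 2 - ι 2 * (x * ι d)) - (ι 2 - x) * (ι 2 - x)
        + ((ι 2 - x) * (ι 2 - x) + ⟦ slope a ⟧ * M)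
        ≈⟨ solve 4 (λ M x d s → M :* (x :* x :+ :ι 2 :- :ι 2 :* (x :* d)) :- (:ι 2 :- x) :* (:ι 2 :- x)
             :+ ((:ι 2 :- x) :* (:ι 2 :- x) :+ s :* M)
             := M :* (x :* x :+ :ι 2 :- :ι 2 :* (x :* d) :+ s)) R.refl M x (ι d) ⟦ slope a ⟧ ⟩
      M * (x * x + ι 2 - ι 2 * (x * ι d) + ⟦ slope a ⟧) ∎))
    where
    x = ⟦ α a ⟧
    t = lastCoordinate a
    d = δ i k ℕ.+ δ i l
    cases : ∀ b {d} → d ≡ 0 ⊎ d ≡ 1 →
      sqDist p q ≈ ⟦ α b ⟧ * ⟦ α b ⟧ + ι 2 - ι 2 * (⟦ α b ⟧ * ι d) + ⟦ slope b ⟧ → TwoFour p q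
    cases (x1 _) {d} _ e = inj₁ (R.trans e
      (solve 1 (λ d → :ι 0 :* :ι 0 :+ :ι 2 :- :ι 2 :* (:ι 0 :* d) :+ :ι 0 := :ι 2) R.refl (ι d)))
    cases (x2 _) {d} _ e = inj₂ (R.trans e
      (solve 1 (λ d → :ι 0 :* :ι 0 :+ :ι 2 :- :ι 2 :* (:ι 0 :* d) :+ :ι 2 := :ι 4) R.refl (ι d)))
    cases (x3 _) (inj₁ refl) e = inj₂ (R.trans e
      (solve 0 (:ι 1 :* :ι 1 :+ :ι 2 :- :ι 2 :* (:ι 1 :* :ι 0) :+ :ι 1 := :ι 4) R.refl))
    cases (x3 _) (inj₂ refl) e = inj₁ (R.trans e
      (solve 0 (:ι 1 :* :ι 1 :+ :ι 2 :- :ι 2 :* (:ι 1 :* :ι 1) :+ :ι 1 := :ι 2) R.refl))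
    cases (x4 _) (inj₁ refl) e = inj₁ (R.trans e
      (solve 0 (con -1ℤ :* con -1ℤ :+ :ι 2 :- :ι 2 :* (con -1ℤ :* :ι 0) :+ con -1ℤ := :ι 2) R.refl))
    cases (x4 _) (inj₂ refl) e = inj₂ (R.trans e
      (solve 0 (con -1ℤ :* con -1ℤ :+ :ι 2 :- :ι 2 :* (con -1ℤ :* :ι 1) :+ con -1ℤ := :ι 4) R.refl))

  sqDist-meet : ∀ i j k l p q → i ≢ j → k ≢ l →
    p ∈ HasCoordinates (pair i j) 0# → q ∈ HasCoordinates (pair k l) 0# →
    sqDist p q ≈ ι 4 - ι 2 * ι (meet i j k l)
  sqDist-meet i j k l p q i≢j k≢l P Q = R.trans (sqDist-pairs i j k l p q i≢j k≢l P Q)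
    (R.+-congˡ (R.-‿cong (R.*-congˡ (R.trans
      (R.+-cong (R.sym (ι-+ (δ i k) (δ j k))) (R.sym (ι-+ (δ i l) (δ j l))))
      (R.sym (ι-+ (δ i k ℕ.+ δ j k) (δ i l ℕ.+ δ j l)))))))

  meet-twoFour : ∀ i j k l p q → i ≢ j → k ≢ l → meet i j k l ≡ 0 ⊎ meet i j k l ≡ 1 →
    p ∈ HasCoordinates (pair i j) 0# → q ∈ HasCoordinates (pair k l) 0# → TwoFour p q
  meet-twoFour i j k l p q i≢j k≢l c P Q = cases c (sqDist-meet i j k l p q i≢j k≢l P Q)
    where
    cases : ∀ {d} → d ≡ 0 ⊎ d ≡ 1 → sqDist p q ≈ ι 4 - ι 2 * ι d → TwoFour p q
    cases (inj₁ refl) e = inj₂ (R.trans e (solve 0 (:ι 4 :- :ι 2 :* :ι 0 := :ι 4) R.refl))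
    cases (inj₂ refl) e = inj₁ (R.trans e (solve 0 (:ι 4 :- :ι 2 :* :ι 1 := :ι 2) R.refl))

  pair-pair : ∀ p q → IsPair p → IsPair q → Near p q
  pair-pair p q (i , j , i<j , P) (k , l , k<l , Q) with meet-cases i<j k<l
  ... | inj₁ (refl , refl) = inj₁ (coordinates-≋ p q P Q)
  ... | inj₂ c = inj₂ (meet-twoFour i j k l p q (Finₚ.<⇒≢ i<j) (Finₚ.<⇒≢ k<l) c P Q)

  pairPoint : Fin m × Fin m → Point
  pairPoint (i , j) = snoc (pair i j) 0#

  spikePoint : Name → Fin m → Point
  spikePoint a i = snoc (spike (centre a) ⟦ α a ⟧ i) (lastCoordinate a)

  pairPoint-coordinates : ∀ i j → pairPoint (i , j) ∈ HasCoordinates (pair i j) 0#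
  pairPoint-coordinates i j = snoc-coordinates (pair i j) 0#

  spikePoint-coordinates : ∀ a i → spikePoint a i ∈ Spike a i
  spikePoint-coordinates a i =
    snoc-coordinates (spike (centre a) ⟦ α a ⟧ i) (lastCoordinate a)

  spike-spike : ∀ ws a b i j p q → Present n a → Present n b → Distances ws m a b →
    p ∈ Spike a i → q ∈ Spike b j → Any (λ w → sqDist p q ≈ ι w) ws
  spike-spike ws a b i j p q pa pb (d₀ ∷ d₁ ∷ []) P Q =
    Any.map (λ {w} → sqDist⇐ a b pa pb i j w p q P Q)
      ([ (λ e → ≡.subst (λ δ → Any (AtDistance m a b δ) ws) (≡.sym e) d₀)
       , (λ e → ≡.subst (λ δ → Any (AtDistance m a b δ) ws) (≡.sym e) d₁) ]′ (δ-cases i j))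

  apart⇒twoFour : ∀ a b i j p q → Present n a → Present n b → Apart m a b →
    p ∈ Spike a i → q ∈ Spike b j → TwoFour p q
  apart⇒twoFour a b i j p q pa pb c P Q with spike-spike (2 ∷ 4 ∷ []) a b i j p q pa pb c P Q
  ... | here e         = inj₁ e
  ... | there (here e) = inj₂ e

  near⇒distance : ∀ p q → Near p q → Any (λ w → sqDist p q ≈ ι w) (0 ∷ 2 ∷ 4 ∷ [])
  near⇒distance p q (inj₁ e)        = here (sqDist-≋ p q e)
  near⇒distance p q (inj₂ (inj₁ e)) = there (here e)
  near⇒distance p q (inj₂ (inj₂ e)) = there (there (here e))

  near⇒compatible : ∀ a b → Present n a → Present n b →
    (∀ i j → Near (spikePoint a i) (spikePoint b j)) → Compatible m a b
  -- The index pairs `(0, 1)` and `(0, 0)` realise `δ = 0` and `δ = 1`.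
  near⇒compatible a b pa pb near = at zero (suc zero) ∷ at zero zero ∷ []
    where
    at : ∀ i j → Any (AtDistance m a b (δ i j)) (0 ∷ 2 ∷ 4 ∷ [])
    at i j = Any.map (λ {w} → sqDist⇒ a b pa pb i j w (spikePoint a i) (spikePoint b j)
      (spikePoint-coordinates a i) (spikePoint-coordinates b j))
      (near⇒distance (spikePoint a i) (spikePoint b j) (near i j))

  -- Centres and last coordinates agree, so the difference is `α` times a difference of two unit
  -- vectors.
  sqDist-same : ∀ a i j p q → p ∈ Spike a i → q ∈ Spike a j →
    sqDist p q ≈ ι 2 * (⟦ α a ⟧ * ⟦ α a ⟧) * (1# - unit i j)
  sqDist-same a i j p q P Q = *-cancelˡ-≈ M M≉0 (R.trans
    (sqDist-spikes i j p q (M*centre a) (M*centre a) P Q)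
    (solve 4 (λ M x d t → M :* (x :* x :+ x :* x :- :ι 2 :* (x :* x :* d)) :- (x :- x) :* (x :- x)
        :+ (:1 :+ M) :* ((t :- t) :* (t :- t)) := M :* (:ι 2 :* (x :* x) :* (:1 :- d)))
      R.refl M ⟦ α a ⟧ (unit i j) (lastCoordinate a)))

  same-near : ∀ a i j p q → p ∈ Spike a i → q ∈ Spike a j → Near p q
  same-near a i j p q P Q = cases a (δ-cases i j) (sqDist-same a i j p q P Q)
    where
    cases : ∀ b {d} → d ≡ 0 ⊎ d ≡ 1 →
      sqDist p q ≈ ι 2 * (⟦ α b ⟧ * ⟦ α b ⟧) * (1# - ι d) → Near p q
    cases (x1 _) {d} _ e = inj₁ (sqDist-zero p q (R.trans e
      (solve 1 (λ d → :ι 2 :* (:ι 0 :* :ι 0) :* (:1 :- d) := :ι 0) R.refl (ι d))))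
    cases (x2 _) {d} _ e = inj₁ (sqDist-zero p q (R.trans e
      (solve 1 (λ d → :ι 2 :* (:ι 0 :* :ι 0) :* (:1 :- d) := :ι 0) R.refl (ι d))))
    cases (x3 _) (inj₁ refl) e = inj₂ (inj₁ (R.trans e
      (solve 0 (:ι 2 :* (:ι 1 :* :ι 1) :* (:1 :- :ι 0) := :ι 2) R.refl)))
    cases (x4 _) (inj₁ refl) e = inj₂ (inj₁ (R.trans e
      (solve 0 (:ι 2 :* (con -1ℤ :* con -1ℤ) :* (:1 :- :ι 0) := :ι 2) R.refl)))
    cases b (inj₂ refl) e = inj₁ (sqDist-zero p q (R.trans e
      (solve 1 (λ x → :ι 2 :* (x :* x) :* (:1 :- :ι 1) := :ι 0) R.refl ⟦ α b ⟧)))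

  0≤sqDist : ∀ p q → 0# ≤ sqDist p q
  0≤sqDist p q = 0≤‖‖² (λ i → p i - q i)

  √2≉√4 : √ (ι 2) ≉ √ (ι 4)
  √2≉√4 e = contradiction (⟦⟧-cancel {+ 2} {+ 4} (√-injective (0≤ι 2) (0≤ι 4) e)) (λ ())

  dist-√ : ∀ p q {x} → sqDist p q ≈ x → dist p q ≈ √ x
  dist-√ p q e = √-cong (0≤sqDist p q) e

  module _ (A : PointSet) (J⊆A : ∀ p → p ∈ J̃′ → p ∈ A) where

    occurs : ∀ i j k l {x} → i ≢ j → k ≢ l → (d : meet i j k l ≡ 0 ⊎ meet i j k l ≡ 1) →
      ι 4 - ι 2 * ι (meet i j k l) ≈ x → OccursAsDistance A (√ x)
    occurs i j k l i≢j k≢l c e = p , q , J⊆A p (pair⇒J̃′ p i≢j P) , J⊆A q (pair⇒J̃′ q k≢l Q) ,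
      twoFour⇒≉ p q (meet-twoFour i j k l p q i≢j k≢l c P Q) ,
      dist-√ p q (R.trans (sqDist-meet i j k l p q i≢j k≢l P Q) e)
      where
      p = pairPoint (i , j)
      q = pairPoint (k , l)
      P = pairPoint-coordinates i j
      Q = pairPoint-coordinates k l

    occurs-√2 : OccursAsDistance A (√ (ι 2))
    occurs-√2 = occurs zero (suc zero) zero (suc (suc zero)) (λ ()) (λ ()) (inj₂ refl)
      (solve 0 (:ι 4 :- :ι 2 :* :ι 1 := :ι 2) R.refl)

    occurs-√4 : OccursAsDistance A (√ (ι 4))
    -- Disjoint pairs take four coordinates besides the last one, which `n ≥ 5` provides.
    occurs-√4 = occurs zero (suc zero) (suc (suc zero)) (suc (suc (suc zero))) (λ ()) (λ ()) (inj₁ refl)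
      (solve 0 (:ι 4 :- :ι 2 :* :ι 0 := :ι 4) R.refl)

    near⇒twoDistance : Finite A → (∀ p q → p ∈ A → q ∈ A → Near p q) → TwoDistance A
    near⇒twoDistance finite near = finite , √ (ι 2) , √ (ι 4) , √2≉√4 , occurs-√2 , occurs-√4 , only
      where
      only : ∀ r → OccursAsDistance A r → r ≈ √ (ι 2) ⊎ r ≈ √ (ι 4)
      only r (p , q , p∈A , q∈A , p≉q , d≈r) with near p q p∈A q∈A
      ... | inj₁ p≋q      = ⊥-elim (p≉q p≋q)
      ... | inj₂ (inj₁ e) = inj₁ (R.trans (R.sym d≈r) (dist-√ p q e))
      ... | inj₂ (inj₂ e) = inj₂ (R.trans (R.sym d≈r) (dist-√ p q e))

    -- J̃′ attains √2 and √4 already, so the unspecified distances `r₁` and `r₂` are these two in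
    -- some order.
    twoDistance⇒twoFour : TwoDistance A → ∀ p q → p ∈ A → q ∈ A → ¬ (p ≋ q) → TwoFour p q
    twoDistance⇒twoFour (_ , r₁ , r₂ , _ , _ , _ , only) p q p∈A q∈A p≉q =
      Sum.map (√-injective (0≤sqDist p q) (0≤ι 2)) (√-injective (0≤sqDist p q) (0≤ι 4))
        (match √2≉√4 (only _ occurs-√2) (only _ occurs-√4)
          (only (dist p q) (p , q , p∈A , q∈A , p≉q , R.refl)))
      where
      match : ∀ {s t d} → s ≉ t → s ≈ r₁ ⊎ s ≈ r₂ → t ≈ r₁ ⊎ t ≈ r₂ → d ≈ r₁ ⊎ d ≈ r₂ → d ≈ s ⊎ d ≈ t
      match s≉t (inj₁ s) (inj₁ t) _        = ⊥-elim (s≉t (R.trans s (R.sym t)))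
      match s≉t (inj₂ s) (inj₂ t) _        = ⊥-elim (s≉t (R.trans s (R.sym t)))
      match s≉t (inj₁ s) (inj₂ t) (inj₁ d) = inj₁ (R.trans d (R.sym s))
      match s≉t (inj₁ s) (inj₂ t) (inj₂ d) = inj₂ (R.trans d (R.sym t))
      match s≉t (inj₂ s) (inj₁ t) (inj₁ d) = inj₂ (R.trans d (R.sym t))
      match s≉t (inj₂ s) (inj₁ t) (inj₂ d) = inj₁ (R.trans d (R.sym s))

-- Classification of the vectors that extend J̃′

data Step : ℤ → Set where
  level : Step 0ℤ
  up    : Step 1ℤ
  down  : Step -1ℤ

-- Parity: the sum of two odd steps is even, hence not an odd step. Applied to the differences among
-- three coordinates, it makes two of them equal.
some-level : ∀ {ε η θ} → Step ε → Step η → Step θ → θ ≡ ε Int.+ η → ε ≡ 0ℤ ⊎ η ≡ 0ℤ ⊎ θ ≡ 0ℤ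
some-level level _     _     _ = inj₁ refl
some-level _     level _     _ = inj₂ (inj₁ refl)
some-level _     _     level _ = inj₂ (inj₂ refl)
some-level up    up    up    ()
some-level up    up    down  ()
some-level up    down  up    ()
some-level up    down  down  ()
some-level down  up    up    ()
some-level down  up    down  ()
some-level down  down  up    ()
some-level down  down  down  ()

-- Nonzero steps whose sum is a step are opposite; their difference is then 2 or -2, too large for a
-- step.
opposite-steps : ∀ {ε η θ} → Step ε → Step η → Step θ → ε ≢ 0ℤ → η ≢ 0ℤ →
  ε Int.+ η ≡ θ → ∀ {κ} → Step κ → ε ≢ η Int.+ κ
opposite-steps level _     _     ε≢0 _   _ _ _ = ε≢0 refl
opposite-steps _     level _     _   η≢0 _ _ _ = η≢0 refl
opposite-steps up    up    level _ _ ()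
opposite-steps up    up    up    _ _ ()
opposite-steps up    up    down  _ _ ()
opposite-steps down  down  level _ _ ()
opposite-steps down  down  up    _ _ ()
opposite-steps down  down  down  _ _ ()
opposite-steps up    down  _     _ _ _ level ()
opposite-steps up    down  _     _ _ _ up    ()
opposite-steps up    down  _     _ _ _ down  ()
opposite-steps down  up    _     _ _ _ level ()
opposite-steps down  up    _     _ _ _ up    ()
opposite-steps down  up    _     _ _ _ down  ()

two-others : ∀ {d} (i : Fin (3 ℕ.+ d)) → ∃ λ k → ∃ λ l → k ≢ l × i ≢ k × i ≢ l
two-others zero          = suc zero , suc (suc zero) , (λ ()) , (λ ()) , (λ ())
two-others (suc zero)    = zero , suc (suc zero) , (λ ()) , (λ ()) , (λ ())
two-others (suc (suc _)) = zero , suc zero , (λ ()) , (λ ()) , (λ ())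

another : ∀ {d} (i j : Fin (3 ℕ.+ d)) → ∃ λ k → i ≢ k × j ≢ k
another i j with two-others i
... | k , l , k≢l , i≢k , i≢l with j Finₚ.≟ k
...   | no  j≢k  = k , i≢k , j≢k
...   | yes refl = l , i≢l , k≢l

module Classification (ℛ : CompleteOrderedField) (k : ℕ) where

  open RealProperties ℛ
  open Sums ℛ
  open Vectors ℛ k
  open Coordinates ℛ m
  open SquaredDistances ℛ k
  open TwoDistanceSets ℛ k
  open Construction ℛ m renaming (⟦_⟧ to ｛_｝)

  _Differs_ : ℝ → ℝ → Set
  u Differs w = ∃ λ ε → Step ε × u ≈ w + ⟦ ε ⟧

  2-cancel : ∀ {x y} → ι 2 * x ≈ ι 2 * y → x ≈ y
  2-cancel = *-cancelˡ-≈ (ι 2) (ι-suc≉0 1)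

  differs : ∀ {q u w} → q - ι 2 * u ≈ ι 2 ⊎ q - ι 2 * u ≈ ι 4 →
    q - ι 2 * w ≈ ι 2 ⊎ q - ι 2 * w ≈ ι 4 → u Differs w
  differs {q} {u} {w} (inj₁ e) (inj₁ f) = 0ℤ , level , 2-cancel
    (move (R.trans f (R.sym e)) (solve 3 (λ q u w → :ι 2 :* u :+ (q :- :ι 2 :* u) :=
      :ι 2 :* (w :+ :ι 0) :+ (q :- :ι 2 :* w)) R.refl q u w))
  differs {q} {u} {w} (inj₂ e) (inj₂ f) = 0ℤ , level , 2-cancel
    (move (R.trans f (R.sym e)) (solve 3 (λ q u w → :ι 2 :* u :+ (q :- :ι 2 :* u) :=
      :ι 2 :* (w :+ :ι 0) :+ (q :- :ι 2 :* w)) R.refl q u w))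
  differs {q} {u} {w} (inj₁ e) (inj₂ f) = 1ℤ , up , 2-cancel
    (move (R.+-cong f (R.sym e)) (solve 3 (λ q u w → :ι 2 :* u :+ (:ι 4 :+ (q :- :ι 2 :* u)) :=
      :ι 2 :* (w :+ :ι 1) :+ (q :- :ι 2 :* w :+ :ι 2)) R.refl q u w))
  differs {q} {u} {w} (inj₂ e) (inj₁ f) = -1ℤ , down , 2-cancel
    (move (R.+-cong f (R.sym e)) (solve 3 (λ q u w → :ι 2 :* u :+ (:ι 2 :+ (q :- :ι 2 :* u)) :=
      :ι 2 :* (w :+ con -1ℤ) :+ (q :- :ι 2 :* w :+ :ι 4)) R.refl q u w))

  module _ (v : Vector ℝ m)
           (differ : ∀ {i j k l} → i ≢ j → k ≢ l → (v i + v j) Differs (v k + v l)) where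

    -- A common third coordinate cancels, so the condition on sums of two entries passes to single
    -- entries.
    difference : ∀ {i j} → i ≢ j → v i Differs v j
    difference {i} {j} i≢j with another i j
    ... | l , i≢l , j≢l with differ i≢l j≢l
    ...   | ε , step , e = ε , step , move e (solve 4 (λ x y z ε →
            x :+ (y :+ z :+ ε) := y :+ ε :+ (x :+ z)) R.refl (v i) (v j) (v l) ⟦ ε ⟧)

    level-≈ : ∀ {i j ε} → ε ≡ 0ℤ → v i ≈ v j + ⟦ ε ⟧ → v i ≈ v j
    level-≈ refl e = R.trans e (R.+-identityʳ _)

    equal-coordinates : ∃ λ i → ∃ λ j → i ≢ j × v i ≈ v j
    equal-coordinates =
      go (difference {zero} {suc zero} (λ ())) (difference {suc zero} {suc (suc zero)} (λ ()))
         (difference {zero} {suc (suc zero)} (λ ()))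
      where
      go : v zero Differs v (suc zero) → v (suc zero) Differs v (suc (suc zero)) →
           v zero Differs v (suc (suc zero)) → ∃ λ i → ∃ λ j → i ≢ j × v i ≈ v j
      go (ε , s , e) (η , t , f) (θ , u , g) with some-level s t u (⟦⟧-cancel (R.trans
        (move (R.+-cong (R.+-cong (R.sym g) e) f) (solve 6 (λ x y z ε η θ →
          θ :+ (x :+ (y :+ ε) :+ (z :+ η)) := ε :+ η :+ (z :+ θ :+ x :+ y)) R.refl
          (v zero) (v (suc zero)) (v (suc (suc zero))) ⟦ ε ⟧ ⟦ η ⟧ ⟦ θ ⟧))
        (R.sym (⟦⟧-+ ε η))))
      ... | inj₁ z        = zero , suc zero , (λ ()) , level-≈ z e
      ... | inj₂ (inj₁ z) = suc zero , suc (suc zero) , (λ ()) , level-≈ z f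
      ... | inj₂ (inj₂ z) = zero , suc (suc zero) , (λ ()) , level-≈ z g

    -- Suppose `l` and `l′` both deviate from the repeated value. Comparing `{l, l′}` with `{i, j}`
    -- makes the sum of the deviations a step, and comparing `{i, l}` with `{i, l′}` makes their
    -- difference one; `opposite-steps` rules this out.
    exception : ∀ {i j l l′} → i ≢ j → v i ≈ v j → l ≢ l′ → v l ≉ v i → v l′ ≈ v i
    exception {i} {j} {l} {l′} i≢j vi≈vj l≢l′ vl≉vi = decidable-stable (v l′ O.≟ v i) λ vl′≉vi →
      let i≢l  = λ { refl → vl≉vi R.refl }
          i≢l′ = λ { refl → vl′≉vi R.refl } in
      clash vl′≉vi (difference (i≢l ∘ ≡.sym)) (difference (i≢l′ ∘ ≡.sym))
        (differ l≢l′ i≢j) (differ i≢l i≢l′)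
      where
      clash : v l′ ≉ v i → v l Differs v i → v l′ Differs v i →
        (v l + v l′) Differs (v i + v j) → ¬ ((v i + v l) Differs (v i + v l′))
      clash vl′≉vi (ε , s , e) (η , t , f) (θ , u , g) (κ , w , h) =
        opposite-steps s t u (λ z → vl≉vi (level-≈ z e)) (λ z → vl′≉vi (level-≈ z f))
          (⟦⟧-cancel (R.trans (⟦⟧-+ ε η)
            (move (R.+-cong (R.+-cong (R.+-cong (R.sym e) (R.sym f)) g) (R.sym vi≈vj))
              (solve 7 (λ x y c d ε η θ → ε :+ η :+ (x :+ y :+ (c :+ d :+ θ) :+ c) :=
                θ :+ (c :+ ε :+ (c :+ η) :+ (x :+ y) :+ d)) R.refl
                (v l) (v l′) (v i) (v j) ⟦ ε ⟧ ⟦ η ⟧ ⟦ θ ⟧))))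
          w
          (⟦⟧-cancel (R.trans
            (move (R.+-cong (R.+-cong (R.sym e) h) f)
              (solve 6 (λ x y c ε η κ → ε :+ (x :+ (c :+ y :+ κ) :+ (c :+ η)) :=
                η :+ κ :+ (c :+ ε :+ (c :+ x) :+ y)) R.refl
                (v l) (v l′) (v i) ⟦ ε ⟧ ⟦ η ⟧ ⟦ κ ⟧))
            (R.sym (⟦⟧-+ η κ))))

    -- Once a value is repeated, either every coordinate equals it or some coordinate deviates by a
    -- step and `exception` makes it the only one.
    spike-shape : ∃ λ ε → Step ε × (∃ λ c → ∃ λ i → ∀ l → v l ≈ spike c ⟦ ε ⟧ i l)
    spike-shape = go equal-coordinates
      where
      constant : ∀ i → ¬ (∃ λ l → v l ≉ v i) → ∀ l → v l ≈ spike (v i) 0# zero l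
      constant i none l = R.trans (decidable-stable (v l O.≟ v i) (λ e → none (l , e)))
        (solve 2 (λ c d → c := c :+ :ι 0 :* d) R.refl (v i) (unit zero l))
      exceptional : ∀ {i j l ε} → i ≢ j → v i ≈ v j → v l ≉ v i → v l ≈ v i + ⟦ ε ⟧ →
        ∀ l′ → v l′ ≈ spike (v i) ⟦ ε ⟧ l l′
      exceptional {i} {j} {l} {ε} i≢j vi≈vj vl≉vi e l′ with l Finₚ.≟ l′
      ... | yes refl = R.trans e (solve 2 (λ c x → c :+ x := c :+ x :* :ι 1) R.refl (v i) ⟦ ε ⟧)
      ... | no  l≢l′ = R.trans (exception i≢j vi≈vj l≢l′ vl≉vi)
        (solve 2 (λ c x → c := c :+ x :* :ι 0) R.refl (v i) ⟦ ε ⟧)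
      go : (∃ λ i → ∃ λ j → i ≢ j × v i ≈ v j) →
        ∃ λ ε → Step ε × (∃ λ c → ∃ λ i → ∀ l → v l ≈ spike c ⟦ ε ⟧ i l)
      go (i , j , i≢j , vi≈vj) with Finₚ.any? (λ l → ¬? (v l O.≟ v i))
      ... | no  none          = 0ℤ , level , v i , zero , constant i none
      ... | yes (l , vl≉vi) =
        let ε , step , e = difference {l} {i} (λ { refl → vl≉vi R.refl })
        in  ε , step , v i , l , exceptional {ε = ε} i≢j vi≈vj vl≉vi e

  sign-of : ∀ {s r y} → N * (s * s) ≈ y → N * (r * r) ≈ y → ∃ λ sgn → s ≈ ∓[ sgn ] r
  sign-of {s} {r} e f with square-equal (*-cancelˡ-≈ N N≉0 (R.trans e (R.sym f)))
  ... | inj₁ s≈r  = ⊖ , s≈r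
  ... | inj₂ s≈-r = ⊕ , s≈-r

  Named : Point → Set
  Named x = ∃ λ a → Present n a × x ∈ X a

  module _ (x : Point) (x∈H : x ∈ H)
           (twoFour : ∀ k l → k ≢ l → TwoFour x (pairPoint (k , l))) where

    v : Vector ℝ m
    v = x ∘ inject₁

    s : ℝ
    s = x (fromℕ m)

    differ : ∀ {i j k l} → i ≢ j → k ≢ l → (v i + v j) Differs (v k + v l)
    differ {i} {j} {k} {l} i≢j k≢l = differs (at i j i≢j) (at k l k≢l)
      where
      q = ‖ v ‖² + s * s + ι 2
      at : ∀ i j → i ≢ j → q - ι 2 * (v i + v j) ≈ ι 2 ⊎ q - ι 2 * (v i + v j) ≈ ι 4
      at i j i≢j = Sum.map (R.trans (R.sym e)) (R.trans (R.sym e)) (twoFour i j i≢j)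
        where
        e = sqDist-pair {v} {s} i j x (pairPoint (i , j)) i≢j
              ((λ _ → R.refl) , R.refl) (pairPoint-coordinates i j)

    module _ (c : ℝ) (ε : ℤ) (i : Fin m) (v≈ : ∀ l → v l ≈ spike c ⟦ ε ⟧ i l) where

      M*c : M * c ≈ ι 2 - ⟦ ε ⟧ - s
      M*c = move (R.trans (R.sym (R.+-congʳ (R.trans (sum-cong-≋ v≈) (sum-unit c ⟦ ε ⟧ i))))
          (R.trans (R.sym (sum-snoc x)) x∈H))
        (solve 3 (λ e s c → c :+ :ι 2 := :ι 2 :- e :- s :+ (c :+ e :+ s)) R.refl ⟦ ε ⟧ s (M * c))

      x∈spike : x ∈ HasCoordinates (spike c ⟦ ε ⟧ i) s
      x∈spike = v≈ , R.refl

      -- The slope forced by squared distance `w` to a vector of J̃′, where `d` counts the ones of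
      -- that vector at the exceptional coordinate.
      coefficient : ℕ → ℕ → ℤ
      coefficient d w = + w Int.- (ε Int.* ε Int.+ + 2 Int.- + 2 Int.* (ε Int.* + d))

      ⟦coefficient⟧ : ∀ d w → ⟦ coefficient d w ⟧ ≈
        ι w - (⟦ ε ⟧ * ⟦ ε ⟧ + ι 2 - ι 2 * (⟦ ε ⟧ * ι d))
      ⟦coefficient⟧ d w =
        R.trans (⟦⟧-- (+ w) (ε Int.* ε Int.+ + 2 Int.- + 2 Int.* (ε Int.* + d))) (R.+-congˡ (R.-‿cong
        (R.trans (⟦⟧-- (ε Int.* ε Int.+ + 2) (+ 2 Int.* (ε Int.* + d))) (R.+-cong
          (R.trans (⟦⟧-+ (ε Int.* ε) (+ 2)) (R.+-congʳ (⟦⟧-* ε ε)))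
          (R.-‿cong (R.trans (⟦⟧-* (+ 2) (ε Int.* + d)) (R.*-congˡ (⟦⟧-* ε (+ d)))))))))

      N*s² : ∀ k l w → k ≢ l → sqDist x (pairPoint (k , l)) ≈ ι w →
        N * (s * s) ≈ (ι 2 - ⟦ ε ⟧) * (ι 2 - ⟦ ε ⟧) + ⟦ coefficient (δ i k ℕ.+ δ i l) w ⟧ * M
      N*s² k l w k≢l e = R.trans (move (R.trans (R.sym (sqDist-spike-pair i k l x (pairPoint (k , l)) k≢l
          M*c x∈spike (pairPoint-coordinates k l))) (R.*-congˡ e))
        (solve 5 (λ M e u w t → t :+ M :* w := (:ι 2 :- e) :* (:ι 2 :- e)
            :+ (w :- (e :* e :+ :ι 2 :- :ι 2 :* (e :* u))) :* M
            :+ (M :* (e :* e :+ :ι 2 :- :ι 2 :* (e :* u)) :- (:ι 2 :- e) :* (:ι 2 :- e) :+ t))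
          R.refl M ⟦ ε ⟧ (unit i k + unit i l) (ι w) (N * (s * s))))
        (R.+-congˡ (R.*-congʳ (R.sym (R.trans (⟦coefficient⟧ (δ i k ℕ.+ δ i l) w)
          (R.+-congˡ (R.-‿cong (R.+-congˡ (R.-‿cong (R.*-congˡ (R.*-congˡ (ι-+ (δ i k) (δ i l))))))))))))

      coefficient-unique : ∀ {a b} →
        N * (s * s) ≈ (ι 2 - ⟦ ε ⟧) * (ι 2 - ⟦ ε ⟧) + ⟦ a ⟧ * M →
        N * (s * s) ≈ (ι 2 - ⟦ ε ⟧) * (ι 2 - ⟦ ε ⟧) + ⟦ b ⟧ * M → a ≡ b
      coefficient-unique {a} {b} e f = ⟦⟧-cancel (*-cancelʳ-≈ M M≉0 (move (R.trans (R.sym e) f)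
        (solve 3 (λ y A B → A :+ (y :+ B) := B :+ (y :+ A)) R.refl
          ((ι 2 - ⟦ ε ⟧) * (ι 2 - ⟦ ε ⟧)) (⟦ a ⟧ * M) (⟦ b ⟧ * M))))

      -- The value of `n s²` fixes `s` up to sign, and the sign selects the member of the family
      -- `f`. The sum condition then fixes `c`.
      named : ∀ (f : Sign → Name) → (∀ sgn → Present n (f sgn)) →
        (∀ sgn → lastCoordinate (f sgn) ≡ ∓[ sgn ] radius (f ⊕)) → (∀ sgn → α (f sgn) ≡ ε) →
        N * (s * s) ≈ (ι 2 - ⟦ ε ⟧) * (ι 2 - ⟦ ε ⟧) + ⟦ slope (f ⊕) ⟧ * M → Named x
      named f pf last≡ α≡ e with sign-of e (R.trans (N*radius² (f ⊕) (pf ⊕))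
        (R.reflexive (≡.cong (λ ε → (ι 2 - ⟦ ε ⟧) * (ι 2 - ⟦ ε ⟧) + ⟦ slope (f ⊕) ⟧ * M) (α≡ ⊕))))
      ... | sgn , s≈ = f sgn , pf sgn , spike⇒X (f sgn) x (i ,
        coordinates-resp x x (λ l → R.+-cong c≈ (R.*-congʳ (R.reflexive (≡.cong ⟦_⟧ (≡.sym (α≡ sgn))))))
          s≈last (λ _ → R.refl) x∈spike)
        where
        s≈last : s ≈ lastCoordinate (f sgn)
        s≈last = R.trans s≈ (R.reflexive (≡.sym (last≡ sgn)))
        c≈ : c ≈ centre (f sgn)
        c≈ = centre-≈ (f sgn) (R.trans M*c (R.+-cong
          (R.+-congˡ (R.-‿cong (R.reflexive (≡.cong ⟦_⟧ (≡.sym (α≡ sgn)))))) (R.-‿cong s≈last)))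

    -- The right side is `9 - m`, and the left side is nonnegative.
    n≤10 : N * (s * s) ≈ (ι 2 - ⟦ -1ℤ ⟧) * (ι 2 - ⟦ -1ℤ ⟧) + ⟦ -1ℤ ⟧ * M → n ℕ.≤ 10
    n≤10 e = ℕ.s≤s (ℤₚ.drop‿+≤+ (ℤₚ.0≤i-j⇒j≤i {+ 9} {+ m} (⟦⟧-nonNeg⁻¹ (O.≤-respʳ-≈
      (R.trans e (R.trans
        (solve 1 (λ M → (:ι 2 :- con -1ℤ) :* (:ι 2 :- con -1ℤ) :+ con -1ℤ :* M := :ι 9 :- M) R.refl M)
        (R.sym (⟦⟧-- (+ 9) (+ m)))))
      (*-nonNegative 0≤N (square-nonNeg s))))))

    classify : ∀ c {ε} i → Step ε → (∀ l → v l ≈ spike c ⟦ ε ⟧ i l) → Named x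
    classify c {ε} i step v≈ with two-others i
    -- The test pairs are `{k, l}`, which avoids the exceptional coordinate, and `{i, k}`, which
    -- contains it.
    ... | k , l , k≢l , i≢k , i≢l = go step (twoFour k l k≢l) (twoFour i k i≢k)
      where
      at : ∀ {k l} w {d} → δ i k ℕ.+ δ i l ≡ d → k ≢ l → sqDist x (pairPoint (k , l)) ≈ ι w →
        N * (s * s) ≈ (ι 2 - ⟦ ε ⟧) * (ι 2 - ⟦ ε ⟧) + ⟦ coefficient c ε i v≈ d w ⟧ * M
      at {k} {l} w refl k≢l e = N*s² c ε i v≈ k l w k≢l e
      off : δ i k ℕ.+ δ i l ≡ 0
      off = ≡.cong₂ ℕ._+_ (δ-≢ i≢k) (δ-≢ i≢l)
      on : δ i i ℕ.+ δ i k ≡ 1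
      on = ≡.cong₂ ℕ._+_ (δ-≡ {i = i} refl) (δ-≢ i≢k)
      same : ∀ w w′ → sqDist x (pairPoint (k , l)) ≈ ι w → sqDist x (pairPoint (i , k)) ≈ ι w′ →
        coefficient c ε i v≈ 0 w ≡ coefficient c ε i v≈ 1 w′
      same w w′ e f = coefficient-unique c ε i v≈ (at w off k≢l e) (at w′ on i≢k f)
      go : Step ε → TwoFour x (pairPoint (k , l)) → TwoFour x (pairPoint (i , k)) → Named x
      go level (inj₁ e) _ = named c 0ℤ i v≈ x1 (λ _ → tt) (λ _ → refl) (λ _ → refl) (at 2 off k≢l e)
      go level (inj₂ e) _ = named c 0ℤ i v≈ x2 (λ _ → tt) (λ _ → refl) (λ _ → refl) (at 4 off k≢l e)
      go up   (inj₂ e) _ = named c 1ℤ i v≈ x3 (λ _ → tt) (λ _ → refl) (λ _ → refl) (at 4 off k≢l e)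
      go down (inj₁ e) _ = named c -1ℤ i v≈ x4 (λ _ → n≤10 (at 2 off k≢l e)) (λ _ → refl) (λ _ → refl)
        (at 2 off k≢l e)
      -- The slope is `w - 3` by the first pair; by the second it is `w′ - 1` for `ε = 1` and
      -- `w′ - 5` for `ε = -1`. Agreement within `{2, 4}` forces `w = 4` and `w = 2` respectively.
      go up   (inj₁ e) (inj₁ f) = contradiction (same 2 2 e f) (λ ())
      go up   (inj₁ e) (inj₂ f) = contradiction (same 2 4 e f) (λ ())
      go down (inj₂ e) (inj₁ f) = contradiction (same 4 2 e f) (λ ())
      go down (inj₂ e) (inj₂ f) = contradiction (same 4 4 e f) (λ ())

    classification : Named x
    classification = let ε , step , c , i , v≈ = spike-shape v differ in classify c i step v≈

-- Extensions, unions and their cardinalities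

All-AllPairs : ∀ {A : Set} {P : A → Set} {R : A → A → Set} {xs} →
  All P xs → AllPairs R xs → AllPairs (λ x y → P x × P y × R x y) xs
All-AllPairs []         []         = []
All-AllPairs (px ∷ pxs) (rx ∷ rxs) =
  All.zipWith (λ (py , r) → px , py , r) (pxs , rx) ∷ All-AllPairs pxs rxs

AllPairs-lookup : ∀ {A : Set} {R : A → A → Set} {xs x y} → AllPairs R xs → x ∈ₗ xs → y ∈ₗ xs →
  x ≡ y ⊎ R x y ⊎ R y x
AllPairs-lookup (_ ∷ _)  (here refl) (here refl) = inj₁ refl
AllPairs-lookup (r ∷ _)  (here refl) (there y)   = inj₂ (inj₁ (All.lookup r y))
AllPairs-lookup (r ∷ _)  (there x)   (here refl) = inj₂ (inj₂ (All.lookup r x))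
AllPairs-lookup (_ ∷ rs) (there x)   (there y)   = AllPairs-lookup rs x y

pairs-< : ∀ d → All (λ (i , j) → i Fin.< j) (pairs d)
pairs-< d = Allₚ.all-filter (λ (i , j) → i Finₚ.<? j) (cartesianProduct (allFin d) (allFin d))

∈-pairs : ∀ {d} {i j : Fin d} → i Fin.< j → (i , j) ∈ₗ pairs d
∈-pairs {i = i} {j} i<j = ∈-filter⁺ (λ (i , j) → i Finₚ.<? j)
  (∈-cartesianProduct⁺ (∈-allFin i) (∈-allFin j)) i<j

pairs-unique : ∀ d → Unique (pairs d)
pairs-unique d = filter⁺ (λ (i , j) → i Finₚ.<? j) (cartesianProduct⁺ (allFin⁺ d) (allFin⁺ d))

module Unions (ℛ : CompleteOrderedField) (k : ℕ) where

  open RealProperties ℛ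
  open Sums ℛ
  open Vectors ℛ k
  open Coordinates ℛ m
  open SquaredDistances ℛ k
  open TwoDistanceSets ℛ k
  open Classification ℛ k
  open Construction ℛ m renaming (⟦_⟧ to ｛_｝)

  spike-resp : ∀ a i p q → q ≋ p → p ∈ Spike a i → q ∈ Spike a i
  spike-resp a i p q = coordinates-resp p q (λ _ → R.refl) R.refl

  J̃′-list : List Point
  J̃′-list = map pairPoint (pairs m)

  X-list : Name → List Point
  X-list a = map (spikePoint a) (positions (3 ℕ.+ k) a)

  J̃′-enumerates : Enumerates J̃′-list J̃′
  J̃′-enumerates p = mk⇔ to from
    where
    to : p ∈ J̃′ → Any (p ≋_) J̃′-list
    to p∈J with J̃′⇒pair p p∈J
    ... | i , j , i<j , P = Anyₚ.map⁺ (lose (∈-pairs i<j)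
      (coordinates-≋ p (pairPoint (i , j)) P (pairPoint-coordinates i j)))
    from : Any (p ≋_) J̃′-list → p ∈ J̃′
    from p∈ with find (Anyₚ.map⁻ p∈)
    ... | (i , j) , ij∈ , p≋ = pair⇒J̃′ p (Finₚ.<⇒≢ (All.lookup (pairs-< m) ij∈))
      (coordinates-resp (pairPoint (i , j)) p (λ _ → R.refl) R.refl p≋ (pairPoint-coordinates i j))

  same-≋ : ∀ a i j p q → ⟦ α a ⟧ ≈ 0# → p ∈ Spike a i → q ∈ Spike a j → p ≋ q
  same-≋ a i j p q α≈0 P Q = sqDist-zero p q (R.trans (sqDist-same a i j p q P Q) (R.trans
    (R.*-congʳ (R.*-congˡ (R.*-congʳ α≈0)))
    (solve 2 (λ x d → :ι 2 :* (:ι 0 :* x) :* d := :ι 0) R.refl ⟦ α a ⟧ (1# - unit i j))))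

  X-enumerates : ∀ a → Enumerates (X-list a) (X a)
  X-enumerates a p = mk⇔ (λ p∈X → let i , P = X⇒spike a p p∈X in Anyₚ.map⁺ (to a i P)) from
    where
    point-≋ : ∀ a i → p ∈ Spike a i → p ≋ spikePoint a i
    point-≋ a i P = coordinates-≋ p (spikePoint a i) P (spikePoint-coordinates a i)
    to : ∀ a i → p ∈ Spike a i → Any (λ i → p ≋ spikePoint a i) (positions (3 ℕ.+ k) a)
    to a@(x1 _) i P =
      here (same-≋ a i zero p (spikePoint a zero) R.refl P (spikePoint-coordinates a zero))
    to a@(x2 _) i P =
      here (same-≋ a i zero p (spikePoint a zero) R.refl P (spikePoint-coordinates a zero))
    to a@(x3 _) i P = lose (∈-allFin i) (point-≋ a i P)
    to a@(x4 _) i P = lose (∈-allFin i) (point-≋ a i P)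
    from : Any (p ≋_) (X-list a) → p ∈ X a
    from p∈ = let i , _ , p≋ = find (Anyₚ.map⁻ {f = spikePoint a} p∈) in
      spike⇒X a p (i , spike-resp a i (spikePoint a i) p p≋ (spikePoint-coordinates a i))

  Union-list : List Name → List Point
  Union-list = concatMap X-list

  Union-enumerates : ∀ S → Enumerates (Union-list S) (Union S)
  Union-enumerates S p = mk⇔
    (λ p∈U → Anyₚ.concat⁺ (Anyₚ.map⁺ (Any.map (λ {a} → Equivalence.to (X-enumerates a p)) p∈U)))
    (λ p∈ → Any.map (λ {a} → Equivalence.from (X-enumerates a p))
      (Anyₚ.map⁻ (Anyₚ.concat⁻ (map X-list S) p∈)))

  ∪-enumerates : ∀ {xs ys A B} → Enumerates xs A → Enumerates ys B → Enumerates (xs ++ ys) (A ∪ B)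
  ∪-enumerates {xs} eA eB p = mk⇔
    [ (λ p∈A → Anyₚ.++⁺ˡ (Equivalence.to (eA p) p∈A))
    , (λ p∈B → Anyₚ.++⁺ʳ xs (Equivalence.to (eB p) p∈B)) ]′
    (Sum.map (Equivalence.from (eA p)) (Equivalence.from (eB p)) ∘ Anyₚ.++⁻ xs)

  ｛｝-enumerates : ∀ x → Enumerates (x ∷ []) ｛ x ｝
  ｛｝-enumerates x p = mk⇔ here λ { (here e) → e ; (there ()) }

  InSomeX : Point → Set
  InSomeX p = ∃ λ a → Present n a × ∃ λ i → p ∈ Spike a i

  J̃′-X-twoFour : ∀ p q → p ∈ J̃′ → InSomeX q → TwoFour q p
  J̃′-X-twoFour p q p∈J (a , pa , i , Q) with J̃′⇒pair p p∈J
  ... | k , l , k<l , P = spike-pair a i k l q p pa (Finₚ.<⇒≢ k<l) Q P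

  -- Distances inside J̃′ and from J̃′ to any present X a are always admissible, so only those
  -- inside `B` remain to be checked.
  extension : ∀ {xs B} → Enumerates xs B → (∀ p → p ∈ B → InSomeX p) →
    (∀ p q → p ∈ B → q ∈ B → Near p q) → TwoDistance (J̃′ ∪ B)
  extension {xs} {B} enum some near =
    near⇒twoDistance (J̃′ ∪ B) (λ _ → inj₁) (J̃′-list ++ xs , ∪-enumerates J̃′-enumerates enum) near′
    where
    near′ : ∀ p q → p ∈ J̃′ ∪ B → q ∈ J̃′ ∪ B → Near p q
    near′ p q (inj₁ p∈J) (inj₁ q∈J) = pair-pair p q (J̃′⇒pair p p∈J) (J̃′⇒pair q q∈J)
    near′ p q (inj₁ p∈J) (inj₂ q∈B) = near-sym q p (inj₂ (J̃′-X-twoFour p q p∈J (some q q∈B)))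
    near′ p q (inj₂ p∈B) (inj₁ q∈J) = inj₂ (J̃′-X-twoFour q p q∈J (some p p∈B))
    near′ p q (inj₂ p∈B) (inj₂ q∈B) = near p q p∈B q∈B

  X-some : ∀ a p → Present n a → p ∈ X a → InSomeX p
  X-some a p pa p∈X = a , pa , X⇒spike a p p∈X

  -- Otherwise `p` would be at squared distance 2 or 4 from itself.
  X∉J̃′ : ∀ p → InSomeX p → p ∉ J̃′
  X∉J̃′ p some p∈J = twoFour⇒≉ p p (J̃′-X-twoFour p p p∈J some) (λ _ → R.refl)

  X⊆H : ∀ a p → p ∈ X a → p ∈ H
  X⊆H a p p∈X with X⇒spike a p p∈X
  ... | i , v≈ , t≈ = begin
    sum p
      ≈⟨ R.trans (sum-snoc p) (R.+-cong (R.trans (sum-cong-≋ v≈) (sum-unit (centre a) ⟦ α a ⟧ i)) t≈) ⟩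
    M * centre a + ⟦ α a ⟧ + lastCoordinate a
      ≈⟨ R.+-congʳ (R.+-congʳ (M*centre a)) ⟩
    ι 2 - ⟦ α a ⟧ - lastCoordinate a + ⟦ α a ⟧ + lastCoordinate a
      ≈⟨ solve 2 (λ x t → :ι 2 :- x :- t :+ x :+ t := :ι 2) R.refl ⟦ α a ⟧ (lastCoordinate a) ⟩
    ι 2 ∎

  X-extends : ∀ a → Present n a → TwoDistance (J̃′ ∪ X a)
  X-extends a pa = extension (X-enumerates a) (λ p → X-some a p pa) (λ p q p∈X q∈X →
    let i , P = X⇒spike a p p∈X
        j , Q = X⇒spike a q q∈X
    in same-near a i j p q P Q)

  point-extends : ∀ x → (∃ λ a → Present n a × x ∈ X a) → TwoDistance (J̃′ ∪ ｛ x ｝)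
  point-extends x (a , pa , x∈X) = extension (｛｝-enumerates x)
    (λ p p≋x → let i , P = X⇒spike a x x∈X in a , pa , i , spike-resp a i x p p≋x P)
    (λ p q p≋x q≋x → inj₁ (λ i → R.trans (p≋x i) (R.sym (q≋x i))))

  point-named : ∀ x → x ∈ H → x ∉ J̃′ → TwoDistance (J̃′ ∪ ｛ x ｝) → ∃ λ a → Present n a × x ∈ X a
  point-named x x∈H x∉J two = classification x x∈H λ k l k≢l →
    let p = pairPoint (k , l)
        p∈J = pair⇒J̃′ p k≢l (pairPoint-coordinates k l)
    in twoDistance⇒twoFour (J̃′ ∪ ｛ x ｝) (λ _ → inj₁) two x p (inj₂ (λ _ → R.refl)) (inj₁ p∈J)
      (λ x≋p → x∉J (pair⇒J̃′ x k≢l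
        (coordinates-resp p x (λ _ → R.refl) R.refl x≋p (pairPoint-coordinates k l))))

  -- Squared distance 0 at `δ = 1` identifies the two vectors with the same exceptional position,
  -- position by position.
  coincide : ∀ a b → Present n a → Present n b → AtDistance m a b 1 0 →
    ∀ p → p ∈ X a → p ∈ X b
  coincide a b pa pb d p p∈X = let i , P = X⇒spike a p p∈X in
    spike⇒X b p (i , spike-resp b i (spikePoint b i) p
      (sqDist-zero p (spikePoint b i) (sqDist⇐ a b pa pb i i 0 p (spikePoint b i) P
        (spikePoint-coordinates b i)
        (≡.subst (λ δ → AtDistance m a b δ 0) (≡.sym (δ-≡ {i = i} refl)) d)))
      (spikePoint-coordinates b i))

  apart-near : ∀ a b p q → Present n a → Present n b → a ≡ b ⊎ Apart m a b ⊎ Apart m b a →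
    p ∈ X a → q ∈ X b → Near p q
  apart-near a b p q pa pb c p∈X q∈X =
    go (X⇒spike a p p∈X) (X⇒spike b q q∈X) c
    where
    go : (∃ λ i → p ∈ Spike a i) → (∃ λ j → q ∈ Spike b j) → a ≡ b ⊎ Apart m a b ⊎ Apart m b a → Near p q
    go (i , P) (j , Q) (inj₁ refl)     = same-near a i j p q P Q
    go (i , P) (j , Q) (inj₂ (inj₁ c)) = inj₂ (apart⇒twoFour a b i j p q pa pb c P Q)
    go (i , P) (j , Q) (inj₂ (inj₂ c)) = near-sym q p (inj₂ (apart⇒twoFour b a j i q p pb pa c Q P))

  union-extends : ∀ S → All (Present n) S →
    (∀ {a b} → a ∈ₗ S → b ∈ₗ S → a ≡ b ⊎ Apart m a b ⊎ Apart m b a) → TwoDistance (J̃′ ∪ Union S)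
  union-extends S present c = extension (Union-enumerates S)
    (λ p p∈U → let a , a∈S , p∈X = find p∈U in X-some a p (All.lookup present a∈S) p∈X)
    (λ p q p∈U q∈U →
      let a , a∈S , p∈X = find p∈U
          b , b∈S , q∈X = find q∈U
      in apart-near a b p q (All.lookup present a∈S) (All.lookup present b∈S) (c a∈S b∈S) p∈X q∈X)

  union-compatible : ∀ S → All (Present n) S → TwoDistance (J̃′ ∪ Union S) →
    ∀ {a b} → a ∈ₗ S → b ∈ₗ S → Compatible m a b
  union-compatible S present two {a} {b} a∈S b∈S =
    near⇒compatible a b (All.lookup present a∈S) (All.lookup present b∈S) λ i j →
      near (spikePoint a i) (spikePoint b j) (inj₂ (lose a∈S (at a i))) (inj₂ (lose b∈S (at b j)))
    where
    at : ∀ a i → spikePoint a i ∈ X a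
    at a i = spike⇒X a (spikePoint a i) (i , spikePoint-coordinates a i)
    near : ∀ p q → p ∈ J̃′ ∪ Union S → q ∈ J̃′ ∪ Union S → Near p q
    -- Deciding whether the real number `sqDist p q` is zero decides `p ≋ q`.
    near p q p∈ q∈ with sqDist p q O.≟ 0#
    ... | yes e = inj₁ (sqDist-zero p q e)
    ... | no ≉0 = inj₂ (twoDistance⇒twoFour (J̃′ ∪ Union S) (λ _ → inj₁) two p q p∈ q∈
      (λ p≋q → ≉0 (sqDist-≋ p q p≋q)))

  Distinctₚ : Point → Point → Set
  Distinctₚ p q = ¬ (p ≋ q)

  J̃′-unique : AllPairs Distinctₚ J̃′-list
  J̃′-unique = AllPairsₚ.map⁺ (AllPairs.map distinct (All-AllPairs (pairs-< m) (pairs-unique m)))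
    where
    distinct : ∀ {ij kl : Fin m × Fin m} →
      proj₁ ij Fin.< proj₂ ij × proj₁ kl Fin.< proj₂ kl × ij ≢ kl →
      Distinctₚ (pairPoint ij) (pairPoint kl)
    distinct {i , j} {k , l} (i<j , k<l , ≢) with meet-cases i<j k<l
    ... | inj₁ (refl , refl) = contradiction refl ≢
    ... | inj₂ c = twoFour⇒≉ (pairPoint (i , j)) (pairPoint (k , l))
      (meet-twoFour i j k l (pairPoint (i , j)) (pairPoint (k , l)) (Finₚ.<⇒≢ i<j) (Finₚ.<⇒≢ k<l) c
        (pairPoint-coordinates i j) (pairPoint-coordinates k l))

  X-unique : ∀ a → AllPairs Distinctₚ (X-list a)
  X-unique a = AllPairsₚ.map⁺ (go a)
    where
    distinct : ∀ a → ⟦ α a ⟧ * ⟦ α a ⟧ ≈ 1# → ∀ {i j} → i ≢ j →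
      Distinctₚ (spikePoint a i) (spikePoint a j)
    distinct a α² {i} {j} i≢j = twoFour⇒≉ (spikePoint a i) (spikePoint a j) (inj₁ (begin
      sqDist (spikePoint a i) (spikePoint a j)
        ≈⟨ sqDist-same a i j (spikePoint a i) (spikePoint a j)
             (spikePoint-coordinates a i) (spikePoint-coordinates a j) ⟩
      ι 2 * (⟦ α a ⟧ * ⟦ α a ⟧) * (1# - unit i j)
        ≈⟨ R.*-cong (R.*-congˡ α²) (R.+-congˡ (R.-‿cong (R.reflexive (≡.cong ι (δ-≢ i≢j))))) ⟩
      ι 2 * 1# * (1# - 0#)
        ≈⟨ solve 0 (:ι 2 :* :1 :* (:1 :- :ι 0) := :ι 2) R.refl ⟩
      ι 2 ∎))
    go : ∀ a → AllPairs (λ i j → Distinctₚ (spikePoint a i) (spikePoint a j)) (positions (3 ℕ.+ k) a)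
    go (x1 _)   = [] ∷ []
    go (x2 _)   = [] ∷ []
    go a@(x3 _) = AllPairs.map (distinct a (solve 0 (:ι 1 :* :ι 1 := :1) R.refl)) (allFin⁺ m)
    go a@(x4 _) = AllPairs.map (distinct a (solve 0 (con -1ℤ :* con -1ℤ := :1) R.refl)) (allFin⁺ m)

  -- Vectors of sets that are apart have squared distance 2 or 4, so the concatenated enumeration
  -- has no repetition and the sizes add up.
  Union-unique : ∀ S → All (Present n) S → AllPairs (Apart m) S → AllPairs Distinctₚ (Union-list S)
  Union-unique S present apart = AllPairsₚ.concat⁺ (Allₚ.map⁺ (All.universal X-unique S))
    (AllPairsₚ.map⁺ (AllPairs.map (λ {a} {b} (pa , pb , c) → Allₚ.map⁺ (All.universal (λ i →
      Allₚ.map⁺ (All.universal (λ j → twoFour⇒≉ (spikePoint a i) (spikePoint b j)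
        (apart⇒twoFour a b i j (spikePoint a i) (spikePoint b j) pa pb c
          (spikePoint-coordinates a i) (spikePoint-coordinates b j)))
        (positions (3 ℕ.+ k) b))) (positions (3 ℕ.+ k) a)))
      (All-AllPairs present apart)))

  length-Union : ∀ S → length (Union-list S) ≡
    ListAction.sum (map (λ a → length (positions (3 ℕ.+ k) a)) S)
  length-Union []      = refl
  length-Union (a ∷ S) = ≡.trans (length-++ (X-list a))
    (≡.cong₂ ℕ._+_ (length-map (spikePoint a) (positions (3 ℕ.+ k) a)) (length-Union S))

  union-cardinality : ∀ S → All (Present n) S → AllPairs (Apart m) S →
    HasCardinality (J̃′ ∪ Union S) (size (3 ℕ.+ k) S)
  union-cardinality S present apart = J̃′-list ++ Union-list S ,
    ∪-enumerates J̃′-enumerates (Union-enumerates S) ,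
    AllPairsₚ.++⁺ J̃′-unique (Union-unique S present apart) (All.tabulate disjoint) ,
    ≡.trans (length-++ J̃′-list) (≡.cong₂ ℕ._+_ (length-map pairPoint (pairs m)) (length-Union S))
    where
    disjoint : ∀ {p} → p ∈ₗ J̃′-list → All (Distinctₚ p) (Union-list S)
    disjoint {p} p∈ = All.tabulate λ {q} q∈ p≋q →
      let p∈J = Equivalence.from (J̃′-enumerates p) (Any.map (λ { refl _ → R.refl }) p∈)
          q∈U = Equivalence.from (Union-enumerates S q) (Any.map (λ { refl _ → R.refl }) q∈)
          a , a∈S , q∈X = find q∈U
      in twoFour⇒≉ q p (J̃′-X-twoFour p q p∈J (X-some a q (All.lookup present a∈S) q∈X)) (≋-sym p≋q)

  coincide-at-10 : ∀ a b → Present n a → Present n b → m ≡ 9 →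
    AtDistance 9 a b 1 0 × AtDistance 9 b a 1 0 → X a ≐ X b
  coincide-at-10 a b pa pb m≡9 (d , d′) =
    (λ {p} → coincide a b pa pb (≡.subst (λ m → AtDistance m a b 1 0) (≡.sym m≡9) d) p) ,
    (λ {p} → coincide b a pb pa (≡.subst (λ m → AtDistance m b a 1 0) (≡.sym m≡9) d′) p)

  both₄-≐ : ∀ a b → Present n a → Present n b → m ≡ 9 → Both₄ a b → X a ≐ X b
  both₄-≐ a@(x4 s) b@(x4 t) pa pb m≡9 _ = coincide-at-10 a b pa pb m≡9 (at s t)
    where
    at : ∀ s t → AtDistance 9 (x4 s) (x4 t) 1 0 × AtDistance 9 (x4 t) (x4 s) 1 0
    at ⊕ ⊕ = from-yes (atDistance? 9 (x4 ⊕) (x4 ⊕) 1 0 ×-dec atDistance? 9 (x4 ⊕) (x4 ⊕) 1 0)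
    at ⊕ ⊖ = from-yes (atDistance? 9 (x4 ⊕) (x4 ⊖) 1 0 ×-dec atDistance? 9 (x4 ⊖) (x4 ⊕) 1 0)
    at ⊖ ⊕ = from-yes (atDistance? 9 (x4 ⊖) (x4 ⊕) 1 0 ×-dec atDistance? 9 (x4 ⊕) (x4 ⊖) 1 0)
    at ⊖ ⊖ = from-yes (atDistance? 9 (x4 ⊖) (x4 ⊖) 1 0 ×-dec atDistance? 9 (x4 ⊖) (x4 ⊖) 1 0)
  both₄-≐ (x1 _) _ _ _ _ (() , _)
  both₄-≐ (x2 _) _ _ _ _ (() , _)
  both₄-≐ (x3 _) _ _ _ _ (() , _)
  both₄-≐ (x4 _) (x1 _) _ _ _ (_ , ())
  both₄-≐ (x4 _) (x2 _) _ _ _ (_ , ())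
  both₄-≐ (x4 _) (x3 _) _ _ _ (_ , ())

  -- Two distinct sets in the union already single out a listed union, and every other member, being
  -- compatible with both, falls into it.
  union-listed : ∀ S → All (Present n) S →
    (∃ λ a → ∃ λ b → a ∈ₗ S × b ∈ₗ S × Distinct a b) →
    TwoDistance (J̃′ ∪ Union S) → Any (λ Mk → S ⊆ₗ proj₁ Mk) (listed n)
  union-listed S present (a , b , a∈S , b∈S , distinct) two =
    go (classified k a b (All.lookup present a∈S) (All.lookup present b∈S) (compatible a∈S b∈S))
    where
    compatible : ∀ {c d} → c ∈ₗ S → d ∈ₗ S → Compatible m c d
    compatible = union-compatible S present two
    go : a ≡ b ⊎ (m ≡ 9 × Both₄ a b) ⊎
      Any (λ Mk → All (λ c → Present n c → Compatible m c a → Compatible m c b → c ∈ₗ proj₁ Mk) names)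
        (listed n) → Any (λ Mk → S ⊆ₗ proj₁ Mk) (listed n)
    go (inj₁ refl)               = ⊥-elim (distinct ((λ z → z) , (λ z → z)))
    go (inj₂ (inj₁ (m≡9 , both))) = contradiction
      (both₄-≐ a b (All.lookup present a∈S) (All.lookup present b∈S) m≡9 both) distinct
    go (inj₂ (inj₂ cliques)) = Any.map (λ clique {c} c∈S → All.lookup clique (∈-names c)
      (All.lookup present c∈S) (compatible c∈S a∈S) (compatible c∈S b∈S)) cliques

  -- Being apart is a pairwise condition, so it passes from a listed union to all of its sub-unions.
  listed-union : ∀ S → All (Present n) S → Any (λ Mk → S ⊆ₗ proj₁ Mk) (listed n) →
    TwoDistance (J̃′ ∪ Union S)
  listed-union S present any =
    let Mk , Mk∈ , S⊆ = find any
        _ , apart , _ = All.lookup (listed-sound k) Mk∈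
    in union-extends S present (λ a∈S b∈S → AllPairs-lookup apart (S⊆ a∈S) (S⊆ b∈S))

  listed-cardinality : All (λ Mk → HasCardinality (J̃′ ∪ Union (proj₁ Mk)) (proj₂ Mk)) (listed n)
  listed-cardinality = All.map (λ {Mk} (present , apart , size≡) →
    ≡.subst (HasCardinality (J̃′ ∪ Union (proj₁ Mk))) size≡ (union-cardinality (proj₁ Mk) present apart))
    (listed-sound k)

open import Data.Nat.Base using (_≤_)

mainTheorem4 : (ℛ : CompleteOrderedField) (m : ℕ) → 5 ≤ suc m →
    let open Construction ℛ m in
    (n ≡ 10 → X (x4 ⊕) ≐ X (x4 ⊖))
    × ((∀ x → x ∈ H → x ∉ J̃′ →
    TwoDistance (J̃′ ∪ ⟦ x ⟧) ⇔ (∃ λ a → Present n a × x ∈ X a))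
    × (∀ a → Present n a →
    X a ⊆ (H ∖ J̃′) × TwoDistance (J̃′ ∪ X a)))
    × ((∀ (S : List Name) → All (Present n) S →
    (∃ λ a → ∃ λ b → a ∈ₗ S × b ∈ₗ S × Distinct a b) →
    TwoDistance (J̃′ ∪ Union S) ⇔ Any (λ Mk → S ⊆ₗ proj₁ Mk) (listed n))
    × All (λ Mk → HasCardinality (J̃′ ∪ Union (proj₁ Mk)) (proj₂ Mk)) (listed n))
-- `5 ≤ suc m` is unpacked to `m = 4 + k`, so that four permuted coordinates are available by
-- computation.
mainTheorem4 ℛ (suc (suc (suc (suc k)))) (ℕ.s≤s (ℕ.s≤s (ℕ.s≤s (ℕ.s≤s _)))) =
  (λ n≡10 → both₄-≐ (x4 ⊕) (x4 ⊖) (ℕₚ.≤-reflexive n≡10) (ℕₚ.≤-reflexive n≡10)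
    (ℕₚ.suc-injective n≡10) (refl , refl)) ,
  ((λ x x∈H x∉J → mk⇔ (point-named x x∈H x∉J) (point-extends x)) ,
   (λ a pa → (λ {p} p∈X → X⊆H a p p∈X , X∉J̃′ p (X-some a p pa p∈X)) , X-extends a pa)) ,
  (λ S present distinct → mk⇔ (union-listed S present distinct) (listed-union S present)) ,
  listed-cardinality
  where open Unions ℛ k
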